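{- Let $n\ge 3$ and let $H$ be a finite simple connected graph with $n$ vertices and $n+1$ edges such that $H$ contains two edge-disjoint cycles. Then $N(P_H)\le M(n)$.
   Context: For a finite simple graph $G$ on vertex set $[n]$, the symmetric edge polytope is $P_G=\operatorname{conv}\{\pm(e_i-e_j):\{i,j\}\in E(G)\}\subset\mathbb{R}^n$ ($e_i$ the standard basis vectors), and $N(P)$ is the number of facets of a polytope $P$. A wedge $G\vee H$ is a graph obtained by identifying a vertex of $G$ with a vertex of $H$; $C_m$ denotes the cycle with $m$ edges and $e$ a single edge. For $n\ge 3$, $M(n)$ is defined as $N(P_G)$ where $G=C_{k+1}\vee C_{k-1}$ if $n=2k-1$ with $k$ even; $G=C_k\vee C_k$ if $n=2k-1$ with $k$ odd; $G=C_{k+1}\vee C_{k-1}\vee e$ if $n=2k$ with $k$ even; $G=C_k\vee C_k\vee e$ if $n=2k$ with $k$ odd. Explicitly, $M(2k-1)=(k+1)(k-1)\binom{k}{k/2}\binom{k-2}{(k-2)/2}$ for $k$ even, $M(2k-1)=k^2\binom{k-1}{(k-1)/2}^2$ for $k$ odd, and $M(2k)=2M(2k-1)$. -}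

module Defs where

open import Data.Nat as ℕ using (ℕ; zero; suc; _≤_)
open import Data.Nat.DivMod using (_/_; _%_)
open import Data.Nat.Combinatorics using (_C_)
open import Data.Fin as Fin using (Fin; toℕ)
open import Data.Fin.Properties using () renaming (_≟_ to _≟F_)
open import Data.Rational as ℚ using (ℚ; 0ℚ; 1ℚ)
open import Data.List using (List; []; _∷_; length; map; concatMap)
open import Data.List.Membership.Propositional using (_∈_)
open import Data.List.Relation.Unary.Unique.Propositional using (Unique)
open import Data.List.Relation.Unary.All using (All)
open import Data.List.Relation.Unary.AllPairs using (AllPairs)
open import Data.Product using (Σ; _×_; _,_; ∃)
open import Data.Sum using (_⊎_)
open import Data.Bool using (if_then_else_)
open import Relation.Nullary using (¬_; does)
open import Relation.Binary.PropositionalEquality using (_≡_)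
open import Function.Bundles using (_⇔_)

-- Finite simple graphs on vertex set Fin n, given by an edge list.
-- Each edge {i,j} is stored once, as a pair (i , j) with i < j.

record Graph (n : ℕ) : Set where
  field
    edges   : List (Fin n × Fin n)
    ordered : All (λ e → toℕ (Data.Product.proj₁ e) ℕ.< toℕ (Data.Product.proj₂ e)) edges
    nodup   : Unique edges
open Graph public

numEdges : ∀ {n} → Graph n → ℕ
numEdges G = length (edges G)

Adj : ∀ {n} → Graph n → Fin n → Fin n → Set
Adj G u w = ((u , w) ∈ edges G) ⊎ ((w , u) ∈ edges G)

data Reach {n} (G : Graph n) : Fin n → Fin n → Set where
  here : ∀ {u} → Reach G u u
  step : ∀ {u v w} → Adj G u v → Reach G v w → Reach G u w

Connected : ∀ {n} → Graph n → Set
Connected G = ∀ u w → Reach G u w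

private
  consec : ∀ {A : Set} → A → List A → List (A × A)
  consec first []           = []
  consec first (x ∷ [])     = (x , first) ∷ []
  consec first (x ∷ y ∷ xs) = (x , y) ∷ consec first (y ∷ xs)

cycPairs : ∀ {A : Set} → List A → List (A × A)
cycPairs []       = []
cycPairs (x ∷ xs) = consec x (x ∷ xs)

record Cycle {n} (G : Graph n) : Set where
  field
    verts    : List (Fin n)
    long     : 3 ≤ length verts
    distinct : Unique verts
    closed   : All (λ p → Adj G (Data.Product.proj₁ p) (Data.Product.proj₂ p)) (cycPairs verts)
open Cycle public

UsesEdge : ∀ {n} {G : Graph n} → Cycle G → Fin n → Fin n → Set
UsesEdge Cy u w = ((u , w) ∈ cycPairs (verts Cy)) ⊎ ((w , u) ∈ cycPairs (verts Cy))

EdgeDisjoint : ∀ {n} {G : Graph n} → Cycle G → Cycle G → Set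
EdgeDisjoint {n} Cy D = ∀ (u w : Fin n) → UsesEdge Cy u w → ¬ UsesEdge D u w

HasTwoEdgeDisjointCycles : ∀ {n} → Graph n → Set
HasTwoEdgeDisjointCycles G = Σ (Cycle G) λ Cy → Σ (Cycle G) λ D → EdgeDisjoint Cy D

Vecℚ : ℕ → Set
Vecℚ n = Fin n → ℚ

Σℚ : ∀ {k} → (Fin k → ℚ) → ℚ
Σℚ {zero}  f = 0ℚ
Σℚ {suc k} f = f Fin.zero ℚ.+ Σℚ (λ i → f (Fin.suc i))

dot : ∀ {n} → Vecℚ n → Vecℚ n → ℚ
dot a x = Σℚ (λ c → a c ℚ.* x c)

AffIndep : ∀ {n k} → (Fin k → Vecℚ n) → Set
AffIndep {n} {k} p =
  ∀ (λs : Fin k → ℚ) →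
    Σℚ λs ≡ 0ℚ →
    (∀ (c : Fin n) → Σℚ (λ i → λs i ℚ.* p i c) ≡ 0ℚ) →
    ∀ i → λs i ≡ 0ℚ

HasAffIndep : ∀ {n} → (Vecℚ n → Set) → ℕ → Set
HasAffIndep {n} S k = Σ (Fin k → Vecℚ n) λ p → (∀ i → S (p i)) × AffIndep p

-- Polytopes given as convex hulls of a finite list of points

Valid : ∀ {n} → List (Vecℚ n) → Vecℚ n → ℚ → Set
Valid V a b = All (λ v → dot a v ℚ.≤ b) V

-- points of V lying on the face cut out by (a , b); the face is the convex hull of these
FaceVerts : ∀ {n} → List (Vecℚ n) → Vecℚ n → ℚ → Vecℚ n → Set
FaceVerts V a b x = x ∈ V × dot a x ≡ b

AllPts : ∀ {n} → List (Vecℚ n) → Vecℚ n → Set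
AllPts V x = x ∈ V

-- (a , b) defines a facet of conv(V): a face of dimension dim conv(V) - 1,
-- where dim X = (max number of affinely independent points of X) - 1.
IsFacet : ∀ {n} → List (Vecℚ n) → Vecℚ n → ℚ → Set
IsFacet V a b =
  Valid V a b ×
  ∃ λ d → HasAffIndep (AllPts V) (suc d) × ¬ HasAffIndep (AllPts V) (suc (suc d))
        × HasAffIndep (FaceVerts V a b) d × ¬ HasAffIndep (FaceVerts V a b) (suc d)

-- two valid inequalities define the same face (same set of vertices, hence same hull)
SameFace : ∀ {n} → List (Vecℚ n) → (Vecℚ n × ℚ) → (Vecℚ n × ℚ) → Set
SameFace V (a , b) (a' , b') = ∀ x → x ∈ V → (dot a x ≡ b) ⇔ (dot a' x ≡ b')

FacetCount≤ : ∀ {n} → List (Vecℚ n) → ℕ → Set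
FacetCount≤ {n} V m =
  ∀ (fs : List (Vecℚ n × ℚ)) →
    All (λ f → IsFacet V (Data.Product.proj₁ f) (Data.Product.proj₂ f)) fs →
    AllPairs (λ f g → ¬ SameFace V f g) fs →
    length fs ≤ m

unitDiff : ∀ {n} → Fin n → Fin n → Vecℚ n
unitDiff i j c =
  (if does (c ≟F i) then 1ℚ else 0ℚ) ℚ.- (if does (c ≟F j) then 1ℚ else 0ℚ)

sepGens : ∀ {n} → Graph n → List (Vecℚ n)
sepGens G = concatMap (λ e → unitDiff (Data.Product.proj₁ e) (Data.Product.proj₂ e)
                           ∷ unitDiff (Data.Product.proj₂ e) (Data.Product.proj₁ e) ∷ [])
                      (edges G)

SEPFacets≤ : ∀ {n} → Graph n → ℕ → Set
SEPFacets≤ G m = FacetCount≤ (sepGens G) m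

-- value of M(2k-1)
Modd : ℕ → ℕ
Modd k = if does ((k % 2) ℕ.≟ 0)
         then (suc k) ℕ.* (k ℕ.∸ 1) ℕ.* (k C (k / 2)) ℕ.* ((k ℕ.∸ 2) C ((k ℕ.∸ 2) / 2))
         else k ℕ.* k ℕ.* ((k ℕ.∸ 1) C ((k ℕ.∸ 1) / 2)) ℕ.* ((k ℕ.∸ 1) C ((k ℕ.∸ 1) / 2))

M : ℕ → ℕ
M n = if does ((n % 2) ℕ.≟ 1) then Modd ((suc n) / 2) else 2 ℕ.* Modd (n / 2)

{-# OPTIONS --safe #-}
module Submission where

-- A facet with normal a and right-hand side b has b > 0 and |a_u - a_w| ≤ b on every edge.
-- It is determined by the signs of the tight edges, those with |a_u - a_w| = b.  Being a
-- facet, it is rigid: a function on the vertices that is constant along the tight edges is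
-- constant.  As H has only n + 1 edges and removing one edge from each of the two cycles
-- keeps it connected, rigidity forces every edge outside the cycles to be tight and all but
-- at most one edge of each cycle to be tight.  The differences of a sum to
-- zero around a cycle, so the signs on each cycle are balanced.  So the number of facets is at most 2^r F(m) F(m'), where m, m'
-- are the lengths of the cycles, r is the number of remaining edges, F(2k) = C(2k,k) and
-- F(2k+1) = (2k+1) C(2k,k).  Finally F(2k) ≤ 2 F(2k-1) and 4 F(2k-1) ≤ F(2k+1), and F is
-- log-concave on odd numbers, so the bound is largest for odd cycles of nearly equal
-- length with r ≤ 1, where it is M(n).

open import Defs
open import Data.Nat using (ℕ; suc; zero; z≤n; s≤s)
import Data.Nat as ℕ
import Data.Nat.Properties as ℕ
open import Data.Nat.Tactic.RingSolver using (solve-∀)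
open import Data.Bool using (if_then_else_)
open import Data.Empty using (⊥-elim)
open import Data.Fin using (Fin; zero; suc; toℕ; punchIn; punchOut)
open import Data.Fin.Properties using (punchInᵢ≢i; punchOut-cong; punchOut-punchIn) renaming (_≟_ to _≟F_)
open import Data.List using (List; []; _∷_; _++_; length; map; drop; filter; cartesianProduct)
open import Data.List.Membership.Propositional using (_∈_; _∉_; find; lose)
import Data.List.Membership.DecPropositional
open import Data.List.Membership.Propositional.Properties
  using (∈-∃++; ∈-++⁺ˡ; ∈-++⁺ʳ; ∈-++⁻; ∈-map⁺; ∈-map⁻; ∈-filter⁺; ∈-filter⁻; ∈-cartesianProduct⁺;
         ∈-concatMap⁺; ∈-concatMap⁻)
open import Data.List.Properties using (length-map; length-++; length-++-sucʳ; ∷-injectiveˡ; ∷-injectiveʳ)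
open import Data.List.Relation.Binary.Disjoint.Propositional using (Disjoint)
open import Data.List.Relation.Unary.All as All using (All; []; _∷_)
open import Data.List.Relation.Unary.AllPairs as AllPairs using (AllPairs; []; _∷_)
import Data.List.Relation.Unary.AllPairs.Properties as AllPairs
open import Data.List.Relation.Unary.Any using (here; there)
open import Data.List.Relation.Unary.Unique.Propositional using (Unique)
import Data.List.Relation.Unary.Unique.Propositional.Properties as Unique
open import Data.Product using (∃; ∃₂; _×_; _,_; proj₁; proj₂; uncurry; swap)
open import Data.Product.Properties using (≡-dec; ,-injectiveˡ; ,-injectiveʳ)
open import Data.Rational using (ℚ; 0ℚ; 1ℚ)
import Data.Rational as ℚ
import Data.Rational.Properties as ℚ
open import Data.Rational.Solver using (module +-*-Solver)
open import Data.Sum using (_⊎_; inj₁; inj₂)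
open import Function using (_∘_; id; mk⇔)
open import Relation.Binary.PropositionalEquality
open import Relation.Nullary using (¬_; Dec; yes; no; does; ¬?)

-- Central binomial coefficients and the facet numbers of cycles

module Counting where

  open import Data.Nat using (_≤_; _+_; _*_; _^_; _∸_; ⌊_/2⌋)
  open import Data.Nat.Combinatorics using (_C_; nC1≡n; nCk≡nC[n∸k]; nCk+nC[k+1]≡[n+1]C[k+1])
  open import Data.Nat.DivMod using (_/_; _%_; m*n/n≡m)
  open import Data.Nat.Properties

  absorption : ∀ n k → suc k * (suc n C suc k) ≡ suc n * (n C k)
  absorption zero    zero    = refl
  absorption zero    (suc k) = *-zeroʳ k
  absorption (suc n) zero    = begin-equality
    1 * (suc (suc n) C 1)  ≡⟨ *-identityˡ _ ⟩
    suc (suc n) C 1        ≡⟨ nC1≡n (suc (suc n)) ⟩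
    suc (suc n)            ≡⟨ *-identityʳ _ ⟨
    suc (suc n) * 1        ∎
    where open ≤-Reasoning
  absorption (suc n) (suc k) = begin-equality
    suc (suc k) * (suc (suc n) C suc (suc k))
      ≡⟨ cong (suc (suc k) *_) (nCk+nC[k+1]≡[n+1]C[k+1] (suc n) (suc k)) ⟨
    suc (suc k) * (x + y)
      ≡⟨ expand (suc k) x y ⟩
    x + (suc k * x + suc (suc k) * y)
      ≡⟨ cong (x +_) (cong₂ _+_ (absorption n k) (absorption n (suc k))) ⟩
    x + (suc n * (n C k) + suc n * (n C suc k))
      ≡⟨ cong (x +_) (*-distribˡ-+ (suc n) (n C k) (n C suc k)) ⟨
    x + suc n * (n C k + n C suc k)
      ≡⟨ cong (λ z → x + suc n * z) (nCk+nC[k+1]≡[n+1]C[k+1] n k) ⟩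
    suc (suc n) * x ∎
    where
    open ≤-Reasoning
    x = suc n C suc k
    y = suc n C suc (suc k)
    expand : ∀ k x y → suc k * (x + y) ≡ x + (k * x + suc k * y)
    expand = solve-∀

  B : ℕ → ℕ
  B k = (k + k) C k

  -- Two uses of `absorption`, joined by the symmetry of row `2k + 1`, whose two middle entries
  -- agree.
  B-rec : ∀ k → suc k * B (suc k) ≡ 2 * (suc (k + k) * B k)
  B-rec k = begin-equality
    suc k * ((suc k + suc k) C suc k)              ≡⟨ cong (λ z → suc k * (suc z C suc k)) (+-suc k k) ⟩
    suc k * (suc (suc (k + k)) C suc k)            ≡⟨ absorption (suc (k + k)) k ⟩
    suc (suc (k + k)) * (suc (k + k) C k)          ≡⟨ cong (suc (suc (k + k)) *_) symmetric ⟩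
    suc (suc (k + k)) * (suc (k + k) C suc k)      ≡⟨ double k (suc (k + k) C suc k) ⟩
    2 * (suc k * (suc (k + k) C suc k))            ≡⟨ cong (2 *_) (absorption (k + k) k) ⟩
    2 * (suc (k + k) * B k)                        ∎
    where
    open ≤-Reasoning
    symmetric : suc (k + k) C k ≡ suc (k + k) C suc k
    symmetric = trans (nCk≡nC[n∸k] (m≤n⇒m≤1+n (m≤m+n k k)))
                      (cong (suc (k + k) C_) (m+n∸n≡m (suc k) k))
    double : ∀ k x → suc (suc (k + k)) * x ≡ 2 * (suc k * x)
    double = solve-∀

  -- G i is the number of facets of P_C for the odd cycle C of length 2i + 1, and B k
  -- the number for the even cycle of length 2k.
  G : ℕ → ℕ
  G i = suc (i + i) * B i

  -- By `B-rec` the left side is `2 * G k` divided by `k + 1`. This is what lets an even cycle be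
  -- exchanged for an odd cycle one shorter and a bridge.
  B∘suc≤2*G : ∀ k → B (suc k) ≤ 2 * G k
  B∘suc≤2*G k = begin
    B (suc k)          ≤⟨ m≤n*m (B (suc k)) (suc k) ⟩
    suc k * B (suc k)  ≡⟨ B-rec k ⟩
    2 * G k            ∎
    where open ≤-Reasoning

  -- The ratio of `G (suc i)` to `G i` is `4 + 2 / (i + 1)`. The next two lemmas use that it exceeds
  -- 4 and that it decreases.
  G-rec : ∀ i → suc i * G (suc i) ≡ (6 + 4 * i) * G i
  G-rec i = begin-equality
    suc i * (suc (suc i + suc i) * B (suc i))  ≡⟨ pull i (B (suc i)) ⟩
    (3 + 2 * i) * (suc i * B (suc i))          ≡⟨ cong ((3 + 2 * i) *_) (B-rec i) ⟩
    (3 + 2 * i) * (2 * G i)                    ≡⟨ collect i (G i) ⟩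
    (6 + 4 * i) * G i                          ∎
    where
    open ≤-Reasoning
    pull : ∀ i x → suc i * (suc (suc i + suc i) * x) ≡ (3 + 2 * i) * (suc i * x)
    pull = solve-∀
    collect : ∀ i x → (3 + 2 * i) * (2 * x) ≡ (6 + 4 * i) * x
    collect = solve-∀

  4*G≤G∘suc : ∀ i → 4 * G i ≤ G (suc i)
  4*G≤G∘suc i = *-cancelˡ-≤ (suc i) (begin
    suc i * (4 * G i)            ≤⟨ m≤m+n _ (2 * G i) ⟩
    suc i * (4 * G i) + 2 * G i  ≡⟨ collect i (G i) ⟩
    (6 + 4 * i) * G i            ≡⟨ G-rec i ⟨
    suc i * G (suc i)            ∎)
    where
    open ≤-Reasoning
    collect : ∀ i x → suc i * (4 * x) + 2 * x ≡ (6 + 4 * i) * x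
    collect = solve-∀

  G-logConcave : ∀ i d → G i * G (suc (i + d)) ≤ G (suc i) * G (i + d)
  G-logConcave i d = *-cancelˡ-≤ (suc i * suc j) (begin
    suc i * suc j * (G i * G (suc j))            ≡⟨ regroup₁ (suc i) (suc j) (G i) (G (suc j)) ⟩
    suc i * G i * (suc j * G (suc j))            ≡⟨ cong (suc i * G i *_) (G-rec j) ⟩
    -- The ratio of consecutive values at `i` is at least the one at `j = i + d`; after
    -- cross-multiplication the gap is exactly `2 * d`.
    suc i * G i * ((6 + 4 * j) * G j)            ≤⟨ m≤m+n _ (2 * d * (G i * G j)) ⟩
    suc i * G i * ((6 + 4 * j) * G j) + 2 * d * (G i * G j)
                                                 ≡⟨ excess i d (G i) (G j) ⟩
    suc j * G j * ((6 + 4 * i) * G i)            ≡⟨ cong (suc j * G j *_) (G-rec i) ⟨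
    suc j * G j * (suc i * G (suc i))            ≡⟨ regroup₂ (suc i) (suc j) (G (suc i)) (G j) ⟩
    suc i * suc j * (G (suc i) * G j)            ∎)
    where
    open ≤-Reasoning
    j = i + d
    regroup₁ : ∀ p q x y → p * q * (x * y) ≡ p * x * (q * y)
    regroup₁ = solve-∀
    regroup₂ : ∀ p q x y → q * y * (p * x) ≡ p * q * (x * y)
    regroup₂ = solve-∀
    excess : ∀ i d x y → suc i * x * ((6 + 4 * (i + d)) * y) + 2 * d * (x * y)
                        ≡ suc (i + d) * y * ((6 + 4 * i) * x)
    excess = solve-∀

  -- The numbers `Modd` and `M` as maxima

  [k+k]/2≡k : ∀ k → (k + k) / 2 ≡ k
  [k+k]/2≡k k = trans (cong (_/ 2) (twice k)) (m*n/n≡m k 2)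
    where
    twice : ∀ k → k + k ≡ k * 2
    twice = solve-∀

  [k+k]%2≡0 : ∀ k → (k + k) % 2 ≡ 0
  [k+k]%2≡0 zero    = refl
  [k+k]%2≡0 (suc k) rewrite +-suc k k = [k+k]%2≡0 k

  [1+k+k]%2≡1 : ∀ k → suc (k + k) % 2 ≡ 1
  [1+k+k]%2≡1 zero    = refl
  [1+k+k]%2≡1 (suc k) rewrite +-suc k k = [1+k+k]%2≡1 k

  -- The halves enter as variables with equations, so that a caller can supply closed forms that do
  -- not hold by computation.
  Modd-even-val : ∀ k h h′ → k % 2 ≡ 0 → k / 2 ≡ h → (k ∸ 2) / 2 ≡ h′ →
                  Modd k ≡ suc k * (k ∸ 1) * (k C h) * ((k ∸ 2) C h′)
  Modd-even-val k h h′ k%2≡0 refl refl rewrite k%2≡0 = refl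

  Modd-odd-val : ∀ k h → k % 2 ≡ 1 → (k ∸ 1) / 2 ≡ h →
                 Modd k ≡ k * k * ((k ∸ 1) C h) * ((k ∸ 1) C h)
  Modd-odd-val k h k%2≡1 refl rewrite k%2≡1 = refl

  Modd-odd : ∀ i → Modd (suc (i + i)) ≡ G i * G i
  Modd-odd i = trans (Modd-odd-val (suc (i + i)) i ([1+k+k]%2≡1 i) ([k+k]/2≡k i))
                     (regroup (suc (i + i)) (B i))
    where
    regroup : ∀ p x → p * p * x * x ≡ p * x * (p * x)
    regroup = solve-∀

  -- For `k = 2i + 2` the two extremal cycles have the odd lengths `2i + 1` and `2i + 3`.
  Modd-even : ∀ i → Modd (suc i + suc i) ≡ G i * G (suc i)
  Modd-even i = begin-equality
    Modd k
      ≡⟨ Modd-even-val k (suc i) i ([k+k]%2≡0 (suc i)) ([k+k]/2≡k (suc i))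
           (trans (cong (_/ 2) k∸2≡i+i) ([k+k]/2≡k i)) ⟩
    suc k * (k ∸ 1) * B (suc i) * ((k ∸ 2) C i)
      ≡⟨ cong₂ (λ y z → suc k * y * B (suc i) * (z C i)) (+-suc i i) k∸2≡i+i ⟩
    suc k * suc (i + i) * B (suc i) * B i
      ≡⟨ regroup (suc k) (suc (i + i)) (B (suc i)) (B i) ⟩
    G i * G (suc i) ∎
    where
    open ≤-Reasoning
    k = suc i + suc i
    k∸2≡i+i : k ∸ 2 ≡ i + i
    k∸2≡i+i = cong (_∸ 1) (+-suc i i)
    regroup : ∀ p q x y → p * q * x * y ≡ q * y * (p * x)
    regroup = solve-∀

  -- Log-concavity moves two edges from the longer cycle to the shorter one, keeping the sum of the
  -- indices. The gap `d` falls by two until the lengths are equal or differ by two, which are the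
  -- two cases of `Modd`.
  GG≤Modd-sorted : ∀ d i → G i * G (i + d) ≤ Modd (suc (i + (i + d)))
  GG≤Modd-sorted 0 i rewrite +-identityʳ i = ≤-reflexive (sym (Modd-odd i))
  GG≤Modd-sorted 1 i rewrite +-comm i 1 = ≤-reflexive (sym (Modd-even i))
  GG≤Modd-sorted (suc (suc d)) i = begin
    G i * G (i + suc (suc d))            ≡⟨ cong (λ z → G i * G z) (+-suc i (suc d)) ⟩
    G i * G (suc (i + suc d))            ≤⟨ G-logConcave i (suc d) ⟩
    G (suc i) * G (i + suc d)            ≡⟨ cong (λ z → G (suc i) * G z) (+-suc i d) ⟩
    G (suc i) * G (suc i + d)            ≤⟨ GG≤Modd-sorted d (suc i) ⟩
    Modd (suc (suc i + (suc i + d)))     ≡⟨ cong (λ z → Modd (suc z)) (shift i d) ⟩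
    Modd (suc (i + (i + suc (suc d))))   ∎
    where
    open ≤-Reasoning
    shift : ∀ i d → suc i + (suc i + d) ≡ i + (i + suc (suc d))
    shift = solve-∀

  GG≤Modd : ∀ i j → G i * G j ≤ Modd (suc (i + j))
  GG≤Modd i j with ≤-total i j
  ... | inj₁ i≤j = subst (λ z → G i * G z ≤ Modd (suc (i + z))) (m+[n∸m]≡n i≤j) (GG≤Modd-sorted (j ∸ i) i)
  ... | inj₂ j≤i = begin
    G i * G j          ≡⟨ *-comm (G i) (G j) ⟩
    G j * G i          ≤⟨ subst (λ z → G j * G z ≤ Modd (suc (j + z))) (m+[n∸m]≡n j≤i) (GG≤Modd-sorted (i ∸ j) j) ⟩
    Modd (suc (j + i)) ≡⟨ cong (λ z → Modd (suc z)) (+-comm j i) ⟩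
    Modd (suc (i + j)) ∎
    where open ≤-Reasoning

  evenOrOdd : ∀ m → (∃ λ k → m ≡ k + k) ⊎ (∃ λ k → m ≡ suc (k + k))
  evenOrOdd zero = inj₁ (0 , refl)
  evenOrOdd (suc m) with evenOrOdd m
  ... | inj₁ (k , refl) = inj₂ (k , refl)
  ... | inj₂ (k , refl) = inj₁ (suc k , cong suc (sym (+-suc k k)))

  -- Giving a shortest of the two nearly equal odd cycles two more edges gains a factor of at least
  -- 4, and the new pair is again bounded by `GG≤Modd`.
  4*Modd≤Modd∘suc : ∀ s → 4 * Modd (suc s) ≤ Modd (suc (suc s))
  4*Modd≤Modd∘suc s with evenOrOdd s
  ... | inj₁ (i , refl) = begin
    4 * Modd (suc (i + i))   ≡⟨ cong (4 *_) (Modd-odd i) ⟩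
    4 * (G i * G i)          ≡⟨ *-assoc 4 (G i) (G i) ⟨
    4 * G i * G i            ≤⟨ *-monoˡ-≤ (G i) (4*G≤G∘suc i) ⟩
    G (suc i) * G i          ≤⟨ GG≤Modd (suc i) i ⟩
    Modd (suc (suc (i + i))) ∎
    where open ≤-Reasoning
  ... | inj₂ (i , refl) = begin
    4 * Modd (suc (suc (i + i)))   ≡⟨ cong (λ z → 4 * Modd (suc z)) (+-suc i i) ⟨
    4 * Modd (suc i + suc i)       ≡⟨ cong (4 *_) (Modd-even i) ⟩
    4 * (G i * G (suc i))          ≡⟨ *-assoc 4 (G i) (G (suc i)) ⟨
    4 * G i * G (suc i)            ≤⟨ *-monoˡ-≤ (G (suc i)) (4*G≤G∘suc i) ⟩
    G (suc i) * G (suc i)          ≤⟨ GG≤Modd (suc i) (suc i) ⟩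
    Modd (suc (suc i + suc i))     ≡⟨ cong (λ z → Modd (suc (suc z))) (+-suc i i) ⟩
    Modd (suc (suc (suc (i + i)))) ∎
    where open ≤-Reasoning

  M-odd-val : ∀ n h → n % 2 ≡ 1 → suc n / 2 ≡ h → M n ≡ Modd h
  M-odd-val n h n%2≡1 refl rewrite n%2≡1 = refl

  M-even-val : ∀ n h → n % 2 ≡ 0 → n / 2 ≡ h → M n ≡ 2 * Modd h
  M-even-val n h n%2≡0 refl rewrite n%2≡0 = refl

  M-odd : ∀ s → M (suc (s + s)) ≡ Modd (suc s)
  M-odd s = M-odd-val (suc (s + s)) (suc s) ([1+k+k]%2≡1 s)
    (trans (cong (λ z → suc z / 2) (sym (+-suc s s))) ([k+k]/2≡k (suc s)))

  M-even : ∀ s → M (suc (suc (s + s))) ≡ 2 * Modd (suc s)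
  M-even s = trans (cong (λ z → M (suc z)) (sym (+-suc s s)))
    (M-even-val (suc s + suc s) (suc s) ([k+k]%2≡0 (suc s)) ([k+k]/2≡k (suc s)))

  -- Two bridges contribute a factor 4, no more than two further cycle edges do, so bridges are
  -- absorbed in pairs until `r ≤ 1`, the parity split of `M`. Odd cycles with `i + j = s` and `r`
  -- other edges make `r + 2s + 2` edges in all, whence the argument `r + 2s + 1` of `M`.
  2^r*Modd≤M : ∀ r s → 2 ^ r * Modd (suc s) ≤ M (suc (r + (s + s)))
  2^r*Modd≤M 0 s = ≤-reflexive (trans (*-identityˡ _) (sym (M-odd s)))
  2^r*Modd≤M 1 s = ≤-reflexive (sym (M-even s))
  2^r*Modd≤M (suc (suc r)) s = begin
    2 ^ suc (suc r) * Modd (suc s)         ≡⟨ regroup (2 ^ r) (Modd (suc s)) ⟩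
    2 ^ r * (4 * Modd (suc s))             ≤⟨ *-monoʳ-≤ (2 ^ r) (4*Modd≤Modd∘suc s) ⟩
    2 ^ r * Modd (suc (suc s))             ≤⟨ 2^r*Modd≤M r (suc s) ⟩
    M (suc (r + (suc s + suc s)))          ≡⟨ cong (λ z → M (suc z)) (shift r s) ⟩
    M (suc (suc (suc r) + (s + s)))        ∎
    where
    open ≤-Reasoning
    regroup : ∀ p x → 2 * (2 * p) * x ≡ p * (4 * x)
    regroup = solve-∀
    shift : ∀ r s → r + (suc s + suc s) ≡ suc (suc r) + (s + s)
    shift = solve-∀

  Unique⇒length≤ : ∀ {A : Set} {xs ys : List A} → Unique xs → (∀ {x} → x ∈ xs → x ∈ ys) →
                   length xs ≤ length ys
  Unique⇒length≤ [] _ = z≤n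
  Unique⇒length≤ {xs = x ∷ xs} (x∉xs ∷ xs!) xs⊆ys with ∈-∃++ (xs⊆ys (here refl))
  ... | us , vs , refl = begin
    suc (length xs)          ≤⟨ s≤s (Unique⇒length≤ xs! xs⊆us++vs) ⟩
    suc (length (us ++ vs))  ≡⟨ length-++-sucʳ us x vs ⟨
    length (us ++ x ∷ vs)    ∎
    where
    open ≤-Reasoning
    xs⊆us++vs : ∀ {y} → y ∈ xs → y ∈ us ++ vs
    xs⊆us++vs y∈xs with ∈-++⁻ us (xs⊆ys (there y∈xs))
    ... | inj₁ y∈us         = ∈-++⁺ˡ y∈us
    ... | inj₂ (here refl)  = ⊥-elim (All.lookup x∉xs y∈xs refl)
    ... | inj₂ (there y∈vs) = ∈-++⁺ʳ us y∈vs

  -- Enumeration of sign words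

  data Sign : Set where
    pos neg nil : Sign

  #pos #neg #nil : List Sign → ℕ
  #pos []         = 0
  #pos (pos ∷ s)  = suc (#pos s)
  #pos (neg ∷ s)  = #pos s
  #pos (nil ∷ s)  = #pos s
  #neg []         = 0
  #neg (pos ∷ s)  = #neg s
  #neg (neg ∷ s)  = suc (#neg s)
  #neg (nil ∷ s)  = #neg s
  #nil []         = 0
  #nil (pos ∷ s)  = #nil s
  #nil (neg ∷ s)  = #nil s
  #nil (nil ∷ s)  = suc (#nil s)

  length≡# : ∀ s → length s ≡ #nil s + (#pos s + #neg s)
  length≡# []        = refl
  length≡# (pos ∷ s) = trans (cong suc (length≡# s)) (sym (+-suc (#nil s) (#pos s + #neg s)))
  length≡# (neg ∷ s) = trans (cong suc (length≡# s))
    (trans (sym (+-suc (#nil s) (#pos s + #neg s))) (cong (#nil s +_) (sym (+-suc (#pos s) (#neg s)))))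
  length≡# (nil ∷ s) = cong suc (length≡# s)

  -- Built along Pascal's rule instead of by filtering, so that the length is a binomial coefficient
  -- by the same recursion.
  words : ℕ → ℕ → List (List Sign)
  words zero    zero    = [] ∷ []
  words zero    (suc p) = []
  words (suc m) zero    = map (neg ∷_) (words m zero)
  words (suc m) (suc p) = map (pos ∷_) (words m p) ++ map (neg ∷_) (words m (suc p))

  length-words : ∀ m p → length (words m p) ≡ m C p
  length-words zero    zero    = refl
  length-words zero    (suc p) = refl
  length-words (suc m) zero    = trans (length-map _ (words m 0)) (length-words m 0)
  length-words (suc m) (suc p) = begin
    length (map (pos ∷_) (words m p) ++ map (neg ∷_) (words m (suc p)))
      ≡⟨ length-++ (map (pos ∷_) (words m p)) ⟩
    length (map (pos ∷_) (words m p)) + length (map (neg ∷_) (words m (suc p)))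
      ≡⟨ cong₂ _+_ (trans (length-map _ (words m p)) (length-words m p))
                   (trans (length-map _ (words m (suc p))) (length-words m (suc p))) ⟩
    m C p + m C suc p
      ≡⟨ nCk+nC[k+1]≡[n+1]C[k+1] m p ⟩
    suc m C suc p ∎
    where open ≡-Reasoning

  ∈-words : ∀ s → #nil s ≡ 0 → s ∈ words (length s) (#pos s)
  ∈-words []        _ = here refl
  ∈-words (pos ∷ s) z = ∈-++⁺ˡ (∈-map⁺ (pos ∷_) (∈-words s z))
  -- At a successor length `words` branches on the number of `pos`, so that number is split before
  -- the goal reduces.
  ∈-words (neg ∷ s) z with #pos s | ∈-words s z
  ... | zero  | s∈ = ∈-map⁺ (neg ∷_) s∈
  ... | suc p | s∈ = ∈-++⁺ʳ (map (pos ∷_) (words (length s) p)) (∈-map⁺ (neg ∷_) s∈)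

  nilWords : ℕ → ℕ → List (List Sign)
  nilWords zero    p       = []
  nilWords (suc m) zero    = map (nil ∷_) (words m zero) ++ map (neg ∷_) (nilWords m zero)
  nilWords (suc m) (suc p) =
    map (nil ∷_) (words m (suc p)) ++ map (pos ∷_) (nilWords m p) ++ map (neg ∷_) (nilWords m (suc p))

  -- Choose the place of `nil`, then the places of `pos` among the other `m`. The recursion adds the
  -- words that begin with `nil` to the inductive counts.
  length-nilWords : ∀ m p → length (nilWords (suc m) p) ≡ suc m * (m C p)
  length-nilWords zero    zero    = refl
  length-nilWords zero    (suc p) = refl
  length-nilWords (suc m) zero    = begin
    length (map (nil ∷_) (words (suc m) 0) ++ map (neg ∷_) (nilWords (suc m) 0))
      ≡⟨ length-++ (map (nil ∷_) (words (suc m) 0)) ⟩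
    length (map (nil ∷_) (words (suc m) 0)) + length (map (neg ∷_) (nilWords (suc m) 0))
      ≡⟨ cong₂ _+_ (trans (length-map _ (words (suc m) 0)) (length-words (suc m) 0))
                   (trans (length-map _ (nilWords (suc m) 0)) (length-nilWords m 0)) ⟩
    suc (suc m) * 1 ∎
    where open ≡-Reasoning
  length-nilWords (suc m) (suc p) = begin
    length (us ++ vs ++ ws)
      ≡⟨ trans (length-++ us) (cong (length us +_) (length-++ vs)) ⟩
    length us + (length vs + length ws)
      ≡⟨ cong₂ _+_ (trans (length-map _ (words (suc m) (suc p))) (length-words (suc m) (suc p)))
          (cong₂ _+_ (trans (length-map _ (nilWords (suc m) p)) (length-nilWords m p))
                     (trans (length-map _ (nilWords (suc m) (suc p))) (length-nilWords m (suc p)))) ⟩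
    (suc m C suc p) + (suc m * (m C p) + suc m * (m C suc p))
      ≡⟨ cong ((suc m C suc p) +_) (*-distribˡ-+ (suc m) (m C p) (m C suc p)) ⟨
    (suc m C suc p) + suc m * (m C p + m C suc p)
      ≡⟨ cong (λ z → (suc m C suc p) + suc m * z) (nCk+nC[k+1]≡[n+1]C[k+1] m p) ⟩
    suc (suc m) * (suc m C suc p) ∎
    where
    open ≡-Reasoning
    us = map (nil ∷_) (words (suc m) (suc p))
    vs = map (pos ∷_) (nilWords (suc m) p)
    ws = map (neg ∷_) (nilWords (suc m) (suc p))

  ∈-nilWords : ∀ s → #nil s ≡ 1 → s ∈ nilWords (length s) (#pos s)
  ∈-nilWords (pos ∷ s) z =
    ∈-++⁺ʳ (map (nil ∷_) (words (length s) (suc (#pos s)))) (∈-++⁺ˡ (∈-map⁺ (pos ∷_) (∈-nilWords s z)))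
  ∈-nilWords (neg ∷ s) z with #pos s | ∈-nilWords s z
  ... | zero  | s∈ = ∈-++⁺ʳ (map (nil ∷_) (words (length s) 0)) (∈-map⁺ (neg ∷_) s∈)
  ... | suc p | s∈ = ∈-++⁺ʳ (map (nil ∷_) (words (length s) (suc p)))
                       (∈-++⁺ʳ (map (pos ∷_) (nilWords (length s) p)) (∈-map⁺ (neg ∷_) s∈))
  ∈-nilWords (nil ∷ s) z with #pos s | ∈-words s (suc-injective z)
  ... | zero  | s∈ = ∈-++⁺ˡ (∈-map⁺ (nil ∷_) s∈)
  ... | suc p | s∈ = ∈-++⁺ˡ (∈-map⁺ (nil ∷_) s∈)

  allWords : ℕ → List (List Sign)
  allWords zero    = [] ∷ []
  allWords (suc m) = map (pos ∷_) (allWords m) ++ map (neg ∷_) (allWords m)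

  length-allWords : ∀ m → length (allWords m) ≡ 2 ^ m
  length-allWords zero    = refl
  length-allWords (suc m) = begin
    length (map (pos ∷_) (allWords m) ++ map (neg ∷_) (allWords m))
      ≡⟨ length-++ (map (pos ∷_) (allWords m)) ⟩
    length (map (pos ∷_) (allWords m)) + length (map (neg ∷_) (allWords m))
      ≡⟨ cong₂ _+_ (trans (length-map _ (allWords m)) (length-allWords m))
                   (trans (length-map _ (allWords m)) (length-allWords m)) ⟩
    2 ^ m + 2 ^ m
      ≡⟨ cong (2 ^ m +_) (+-identityʳ (2 ^ m)) ⟨
    2 ^ suc m ∎
    where open ≡-Reasoning

  ∈-allWords : ∀ s → #nil s ≡ 0 → s ∈ allWords (length s)
  ∈-allWords []        _ = here refl
  ∈-allWords (pos ∷ s) z = ∈-++⁺ˡ (∈-map⁺ (pos ∷_) (∈-allWords s z))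
  ∈-allWords (neg ∷ s) z = ∈-++⁺ʳ (map (pos ∷_) (allWords (length s))) (∈-map⁺ (neg ∷_) (∈-allWords s z))

  -- Balanced sign words around a cycle

  Balanced : List Sign → Set
  Balanced s = #nil s ≤ 1 × #pos s ≡ #neg s

  +-double-injective : ∀ p k → p + p ≡ k + k → p ≡ k
  +-double-injective p k eq = trans (n≡⌊n+n/2⌋ p) (trans (cong ⌊_/2⌋ eq) (sym (n≡⌊n+n/2⌋ k)))

  -- An even cycle is traded for the odd cycle one shorter and a bridge, which does not
  -- decrease the bound; hence the two parameters.
  record BalancedCodes (m : ℕ) : Set where
    field
      bridges half : ℕ
      size         : bridges + suc (half + half) ≡ m
      codes        : List (List Sign)
      length-codes : length codes ≤ 2 ^ bridges * G half
      complete     : ∀ s → length s ≡ m → Balanced s → s ∈ codes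

  k+k≢1+j+j : ∀ k j → k + k ≢ suc (j + j)
  k+k≢1+j+j k j eq = 0≢1+n (trans (sym ([k+k]%2≡0 k)) (trans (cong (_% 2) eq) ([1+k+k]%2≡1 j)))

  -- A balanced word satisfies `m = #nil s + 2 * #pos s`, so parity decides whether the one
  -- permitted `nil` occurs: `words` covers even lengths and `nilWords` odd ones.
  balancedCodes : ∀ m → 3 ≤ m → BalancedCodes m
  balancedCodes m 3≤m with evenOrOdd m
  balancedCodes .0 () | inj₁ (zero , refl)
  balancedCodes _ _ | inj₁ (suc k , refl) = record
    { bridges      = 1
    ; half         = k
    ; size         = cong suc (sym (+-suc k k))
    ; codes        = words (suc k + suc k) (suc k)
    ; length-codes = ≤-trans (≤-reflexive (length-words (suc k + suc k) (suc k))) (B∘suc≤2*G k)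
    ; complete     = complete
    }
    where
    complete : ∀ s → length s ≡ suc k + suc k → Balanced s → s ∈ words (suc k + suc k) (suc k)
    complete s len (nil≤1 , bal) with #nil s in z | length≡# s
    complete s len (nil≤1 , bal) | 0 | split =
      subst₂ (λ m p → s ∈ words m p) len
        (+-double-injective (#pos s) (suc k) (trans (cong (#pos s +_) bal) (trans (sym split) len))) (∈-words s z)
    complete s len (nil≤1 , bal) | 1 | split =
      ⊥-elim (k+k≢1+j+j (suc k) (#pos s)
        (trans (sym len) (trans split (cong (λ q → suc (#pos s + q)) (sym bal)))))
    complete s len (s≤s () , bal) | suc (suc _) | split
  balancedCodes _ _ | inj₂ (k , refl) = record
    { bridges      = 0
    ; half         = k
    ; size         = refl
    ; codes        = nilWords (suc (k + k)) k
    ; length-codes = ≤-reflexive (trans (length-nilWords (k + k) k) (sym (*-identityˡ (G k))))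
    ; complete     = complete
    }
    where
    complete : ∀ s → length s ≡ suc (k + k) → Balanced s → s ∈ nilWords (suc (k + k)) k
    complete s len (nil≤1 , bal) with #nil s in z | length≡# s
    complete s len (nil≤1 , bal) | 0 | split =
      ⊥-elim (k+k≢1+j+j (#pos s) k (trans (cong (#pos s +_) bal) (trans (sym split) len)))
    complete s len (nil≤1 , bal) | 1 | split =
      subst₂ (λ m p → s ∈ nilWords m p) len
        (+-double-injective (#pos s) k (trans (cong (#pos s +_) bal) (suc-injective (trans (sym split) len))))
        (∈-nilWords s z)
    complete s len (s≤s () , bal) | suc (suc _) | split

open Counting

-- Finite rational sums and linear functionals

module Facets where

  open import Data.Rational using (_+_; _*_; _-_; -_; _≤_; _<_; 1/_; ≢-nonZero)
  open import Data.Rational.Properties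

  *-cancel-≢0 : ∀ x {y} → y ≢ 0ℚ → x * y ≡ 0ℚ → x ≡ 0ℚ
  *-cancel-≢0 x {y} y≢0 xy≡0 = begin
    x                ≡⟨ *-identityʳ x ⟨
    x * 1ℚ           ≡⟨ cong (x *_) (*-inverseʳ y) ⟨
    x * (y * 1/ y)   ≡⟨ *-assoc x y (1/ y) ⟨
    x * y * 1/ y     ≡⟨ cong (_* 1/ y) xy≡0 ⟩
    0ℚ * 1/ y        ≡⟨ *-zeroˡ (1/ y) ⟩
    0ℚ               ∎
    where
    open ≡-Reasoning
    instance _ = ≢-nonZero y≢0

  x-y≡0⇒x≡y : ∀ {x y} → x - y ≡ 0ℚ → x ≡ y
  x-y≡0⇒x≡y {x} {y} eq = begin
    x          ≡⟨ solve 2 (λ x y → x := (x :- y) :+ y) refl x y ⟩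
    x - y + y  ≡⟨ cong (_+ y) eq ⟩
    0ℚ + y     ≡⟨ +-identityˡ y ⟩
    y          ∎
    where
    open ≡-Reasoning
    open +-*-Solver

  x≡y⇒x-y≡0 : ∀ {x y} → x ≡ y → x - y ≡ 0ℚ
  x≡y⇒x-y≡0 {x} refl = +-inverseʳ x

  -[x-y]≡y-x : ∀ x y → - (x - y) ≡ y - x
  -[x-y]≡y-x = solve 2 (λ x y → :- (x :- y) := y :- x) refl
    where open +-*-Solver

  Σ-cong : ∀ {k} {f g : Fin k → ℚ} → (∀ i → f i ≡ g i) → Σℚ f ≡ Σℚ g
  Σ-cong {zero}  eq = refl
  Σ-cong {suc k} eq = cong₂ _+_ (eq zero) (Σ-cong (eq ∘ suc))

  Σ-zero : ∀ k → Σℚ {k} (λ _ → 0ℚ) ≡ 0ℚ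
  Σ-zero zero    = refl
  Σ-zero (suc k) = trans (+-identityˡ _) (Σ-zero k)

  Σ-+ : ∀ {k} (f g : Fin k → ℚ) → Σℚ (λ i → f i + g i) ≡ Σℚ f + Σℚ g
  Σ-+ {zero}  f g = refl
  Σ-+ {suc k} f g = trans (cong ((f zero + g zero) +_) (Σ-+ (f ∘ suc) (g ∘ suc)))
    (solve 4 (λ x y u v → (x :+ y) :+ (u :+ v) := (x :+ u) :+ (y :+ v)) refl
      (f zero) (g zero) (Σℚ (f ∘ suc)) (Σℚ (g ∘ suc)))
    where open +-*-Solver

  Σ-*ˡ : ∀ {k} x (f : Fin k → ℚ) → Σℚ (λ i → x * f i) ≡ x * Σℚ f
  Σ-*ˡ {zero}  x f = sym (*-zeroʳ x)
  Σ-*ˡ {suc k} x f = trans (cong (x * f zero +_) (Σ-*ˡ x (f ∘ suc)))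
                           (sym (*-distribˡ-+ x (f zero) (Σℚ (f ∘ suc))))

  Σ-swap : ∀ {k l} (f : Fin k → Fin l → ℚ) →
           Σℚ (λ i → Σℚ (λ j → f i j)) ≡ Σℚ (λ j → Σℚ (λ i → f i j))
  Σ-swap {zero}  {l} f = sym (Σ-zero l)
  Σ-swap {suc k} {l} f = trans (cong (Σℚ (f zero) +_) (Σ-swap (f ∘ suc)))
                               (sym (Σ-+ (f zero) (λ j → Σℚ (λ i → f (suc i) j))))

  indicator : ∀ {n} → Fin n → Fin n → ℚ
  indicator i c = if does (c ≟F i) then 1ℚ else 0ℚ

  dot-indicator : ∀ {n} (f : Vecℚ n) i → dot f (indicator i) ≡ f i
  dot-indicator {suc n} f zero = begin
    f zero * 1ℚ + Σℚ (λ c → f (suc c) * 0ℚ)  ≡⟨ cong₂ _+_ (*-identityʳ (f zero)) (Σ-cong (λ c → *-zeroʳ (f (suc c)))) ⟩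
    f zero + Σℚ {n} (λ _ → 0ℚ)               ≡⟨ cong (f zero +_) (Σ-zero n) ⟩
    f zero + 0ℚ                              ≡⟨ +-identityʳ (f zero) ⟩
    f zero                                   ∎
    where open ≡-Reasoning
  dot-indicator {suc n} f (suc i) = begin
    f zero * 0ℚ + dot (f ∘ suc) (indicator i)  ≡⟨ cong₂ _+_ (*-zeroʳ (f zero)) (dot-indicator (f ∘ suc) i) ⟩
    0ℚ + f (suc i)                             ≡⟨ +-identityˡ (f (suc i)) ⟩
    f (suc i)                                  ∎
    where open ≡-Reasoning

  dot-unitDiff : ∀ {n} (f : Vecℚ n) u w → dot f (unitDiff u w) ≡ f u - f w
  dot-unitDiff f u w = begin
    Σℚ (λ c → f c * (indicator u c - indicator w c))
      ≡⟨ Σ-cong (λ c → solve 3 (λ x y z → x :* (y :- z) := x :* y :+ :- con 1ℚ :* (x :* z)) refl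
                         (f c) (indicator u c) (indicator w c)) ⟩
    Σℚ (λ c → f c * indicator u c + - 1ℚ * (f c * indicator w c))
      ≡⟨ Σ-+ (λ c → f c * indicator u c) (λ c → - 1ℚ * (f c * indicator w c)) ⟩
    dot f (indicator u) + Σℚ (λ c → - 1ℚ * (f c * indicator w c))
      ≡⟨ cong₂ _+_ (dot-indicator f u)
           (trans (Σ-*ˡ (- 1ℚ) (λ c → f c * indicator w c)) (cong (- 1ℚ *_) (dot-indicator f w))) ⟩
    f u + - 1ℚ * f w
      ≡⟨ solve 2 (λ x y → x :+ :- con 1ℚ :* y := x :- y) refl (f u) (f w) ⟩
    f u - f w ∎
    where
    open ≡-Reasoning
    open +-*-Solver

  -- A linear relation survives every linear functional. Different choices of `f` later isolate
  -- different coefficients of one relation.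
  dot-relation : ∀ {n k} (p : Fin k → Vecℚ n) (λs : Fin k → ℚ) →
                 (∀ c → Σℚ (λ i → λs i * p i c) ≡ 0ℚ) →
                 ∀ f → Σℚ (λ i → λs i * dot f (p i)) ≡ 0ℚ
  dot-relation {n} p λs rel f = begin
    Σℚ (λ i → λs i * Σℚ (λ c → f c * p i c))
      ≡⟨ Σ-cong (λ i → sym (Σ-*ˡ (λs i) (λ c → f c * p i c))) ⟩
    Σℚ (λ i → Σℚ (λ c → λs i * (f c * p i c)))
      ≡⟨ Σ-swap (λ i c → λs i * (f c * p i c)) ⟩
    Σℚ (λ c → Σℚ (λ i → λs i * (f c * p i c)))
      ≡⟨ Σ-cong (λ c → Σ-cong (λ i →
           solve 3 (λ x y z → x :* (y :* z) := y :* (x :* z)) refl (λs i) (f c) (p i c))) ⟩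
    Σℚ (λ c → Σℚ (λ i → f c * (λs i * p i c)))
      ≡⟨ Σ-cong (λ c → trans (Σ-*ˡ (f c) (λ i → λs i * p i c))
                             (trans (cong (f c *_) (rel c)) (*-zeroʳ (f c)))) ⟩
    Σℚ {n} (λ _ → 0ℚ)
      ≡⟨ Σ-zero n ⟩
    0ℚ ∎
    where
    open ≡-Reasoning
    open +-*-Solver

  -- Facet inequalities: positivity and rigidity

  module _ {n} (H : Graph n) where

    unitDiff∈sepGens : ∀ {u w} → Adj H u w → unitDiff u w ∈ sepGens H
    unitDiff∈sepGens (inj₁ e∈) = ∈-concatMap⁺ _ (lose e∈ (here refl))
    unitDiff∈sepGens (inj₂ e∈) = ∈-concatMap⁺ _ (lose e∈ (there (here refl)))

    sepGens⇒unitDiff : ∀ {x} → x ∈ sepGens H → ∃₂ λ u w → Adj H u w × x ≡ unitDiff u w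
    sepGens⇒unitDiff x∈ with find (∈-concatMap⁻ _ {edges H} x∈)
    ... | (u , w) , e∈ , here refl         = u , w , inj₁ e∈ , refl
    ... | (u , w) , e∈ , there (here refl) = w , u , inj₂ e∈ , refl

    Bounded : Vecℚ n → ℚ → Set
    Bounded a b = ∀ {u w} → Adj H u w → a u - a w ≤ b

    -- Dual form of the statement that the tight generators span the same space as all generators.
    Rigid : Vecℚ n → ℚ → Set
    Rigid a b = ∀ (f : Vecℚ n) → (∀ {u w} → Adj H u w → a u - a w ≡ b → f u ≡ f w) →
                ∀ {u w} → Adj H u w → f u ≡ f w

    Valid⇒Bounded : ∀ {a b} → Valid (sepGens H) a b → Bounded a b
    Valid⇒Bounded {a} {b} valid {u} {w} uw =
      subst (_≤ b) (dot-unitDiff a u w) (All.lookup valid (unitDiff∈sepGens uw))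

    Adj-sym : ∀ {u w} → Adj H u w → Adj H w u
    Adj-sym (inj₁ e) = inj₂ e
    Adj-sym (inj₂ e) = inj₁ e

    -- If b ≤ 0 then every generator lies on the face, which is then the whole polytope.
    facet⇒0<b : ∀ {u w a b} → Adj H u w → IsFacet (sepGens H) a b → 0ℚ < b
    facet⇒0<b {u₀} {w₀} {a} {b} u₀w₀ (valid , d , (q , q∈ , q-indep) , _ , _ , ¬face) =
      ≰⇒> (λ b≤0 → ¬face (q , (λ i → q∈ i , on-face b≤0 (q∈ i)) , q-indep))
      where
      bounded = Valid⇒Bounded {a} {b} valid
      diff≡0 : b ≤ 0ℚ → ∀ {u w} → Adj H u w → a u - a w ≡ 0ℚ
      diff≡0 b≤0 {u} {w} uw = ≤-antisym (≤-trans (bounded uw) b≤0)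
        (subst (0ℚ ≤_) (-[x-y]≡y-x (a w) (a u))
          (neg-antimono-≤ (≤-trans (bounded (Adj-sym uw)) b≤0)))
      on-face : b ≤ 0ℚ → ∀ {x} → x ∈ sepGens H → dot a x ≡ b
      on-face b≤0 x∈ with sepGens⇒unitDiff x∈
      ... | u , w , uw , refl = begin
        dot a (unitDiff u w)  ≡⟨ dot-unitDiff a u w ⟩
        a u - a w             ≡⟨ diff≡0 b≤0 uw ⟩
        -- The given edge `u₀w₀` has difference zero, which is at most `b`; this supplies `0ℚ ≤ b`.
        0ℚ                    ≡⟨ ≤-antisym (subst (_≤ b) (diff≡0 b≤0 u₀w₀) (bounded u₀w₀)) b≤0 ⟩
        b                     ∎
        where open ≡-Reasoning

    -- If f were constant on the tight edges but not on the edge uw, then adjoining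
    -- ±(e_u - e_w) to a maximal affinely independent family of the facet would give
    -- too many affinely independent points.
    facet⇒Rigid : ∀ {a b} → 0ℚ < b → IsFacet (sepGens H) a b → Rigid a b
    facet⇒Rigid {a} {b} 0<b (_ , d , _ , ¬all , (p , p∈ , p-indep) , _) f f-tight {u} {w} uw
      with f u ≟ f w
    ... | yes fu≡fw = fu≡fw
    ... | no  fu≢fw = ⊥-elim (¬all (q , q∈ , q-indep))
      where
      open ≡-Reasoning
      open +-*-Solver
      -- Both signs are adjoined, because the face supplies `d` affinely independent points and the
      -- contradiction takes `d + 2`.
      q : Fin (suc (suc d)) → Vecℚ n
      q zero          = unitDiff u w
      q (suc zero)    = unitDiff w u
      q (suc (suc i)) = p i

      q∈ : ∀ i → q i ∈ sepGens H
      q∈ zero          = unitDiff∈sepGens uw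
      q∈ (suc zero)    = unitDiff∈sepGens (Adj-sym uw)
      q∈ (suc (suc i)) = proj₁ (p∈ i)

      dot-f-p : ∀ i → dot f (p i) ≡ 0ℚ
      dot-f-p i with p∈ i
      ... | pi∈ , tight with sepGens⇒unitDiff pi∈
      ... | u′ , w′ , u′w′ , eq rewrite eq =
        trans (dot-unitDiff f u′ w′)
              (x≡y⇒x-y≡0 (f-tight u′w′ (trans (sym (dot-unitDiff a u′ w′)) tight)))

      b≢0 : b ≢ 0ℚ
      b≢0 b≡0 = <⇒≢ 0<b (sym b≡0)

      q-indep : AffIndep q
      q-indep λs Σλ≡0 rel = λ where
          zero          → x≡0
          (suc zero)    → y≡0
          (suc (suc i)) → p-indep μ Σμ≡0 μ-rel i
        where
        x = λs zero
        y = λs (suc zero)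
        μ = λ i → λs (suc (suc i))
        relation : ∀ g → x * (g u - g w) + (y * (g w - g u) + Σℚ (λ i → μ i * dot g (p i))) ≡ 0ℚ
        relation g = trans
          (cong₂ (λ s t → x * s + (y * t + Σℚ (λ i → μ i * dot g (p i))))
            (sym (dot-unitDiff g u w)) (sym (dot-unitDiff g w u)))
          (dot-relation q λs rel g)

        -- Testing the relation with `f` kills every `p i` and leaves `x - y` times the nonzero
        -- difference of `f` on `uw`.
        x≡y : x ≡ y
        x≡y = x-y≡0⇒x≡y (*-cancel-≢0 (x - y) (λ eq → fu≢fw (x-y≡0⇒x≡y eq)) (begin
          (x - y) * (f u - f w)
            ≡⟨ solve 4 (λ x y s t → (x :- y) :* (s :- t) := x :* (s :- t) :+ (y :* (t :- s) :+ con 0ℚ))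
                 refl x y (f u) (f w) ⟩
          x * (f u - f w) + (y * (f w - f u) + 0ℚ)
            ≡⟨ cong (λ z → x * (f u - f w) + (y * (f w - f u) + z))
                 (trans (Σ-cong (λ i → trans (cong (μ i *_) (dot-f-p i)) (*-zeroʳ (μ i)))) (Σ-zero d)) ⟨
          x * (f u - f w) + (y * (f w - f u) + Σℚ (λ i → μ i * dot f (p i)))
            ≡⟨ relation f ⟩
          0ℚ ∎))

        -- Testing with `a`: the opposite vectors now cancel, since `x ≡ y`, and every `p i` has the
        -- value `b`.
        Σμ≡0 : Σℚ μ ≡ 0ℚ
        Σμ≡0 = *-cancel-≢0 (Σℚ μ) b≢0 (begin
          Σℚ μ * b
            ≡⟨ *-comm (Σℚ μ) b ⟩
          b * Σℚ μ
            ≡⟨ Σ-*ˡ b μ ⟨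
          Σℚ (λ i → b * μ i)
            ≡⟨ Σ-cong (λ i → trans (*-comm b (μ i)) (cong (μ i *_) (sym (proj₂ (p∈ i))))) ⟩
          Σℚ (λ i → μ i * dot a (p i))
            ≡⟨ solve 4 (λ x s t z → z := x :* (s :- t) :+ (x :* (t :- s) :+ z)) refl x (a u) (a w) _ ⟩
          x * (a u - a w) + (x * (a w - a u) + Σℚ (λ i → μ i * dot a (p i)))
            ≡⟨ cong (λ z → x * (a u - a w) + (z * (a w - a u) + Σℚ (λ i → μ i * dot a (p i)))) x≡y ⟩
          x * (a u - a w) + (y * (a w - a u) + Σℚ (λ i → μ i * dot a (p i)))
            ≡⟨ relation a ⟩
          0ℚ ∎)

        -- The sum of all coefficients is zero and has shrunk to `x + y`, which is twice `x`.
        x≡0 : x ≡ 0ℚ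
        x≡0 = *-cancel-≢0 x {1ℚ + 1ℚ} (λ ()) (begin
          x * (1ℚ + 1ℚ)     ≡⟨ solve 1 (λ x → x :* (con 1ℚ :+ con 1ℚ) := x :+ (x :+ con 0ℚ)) refl x ⟩
          x + (x + 0ℚ)      ≡⟨ cong₂ (λ s t → x + (s + t)) x≡y (sym Σμ≡0) ⟩
          x + (y + Σℚ μ)    ≡⟨ Σλ≡0 ⟩
          0ℚ                ∎)

        y≡0 : y ≡ 0ℚ
        y≡0 = trans (sym x≡y) x≡0

        μ-rel : ∀ c → Σℚ (λ i → μ i * p i c) ≡ 0ℚ
        μ-rel c = begin
          z
            ≡⟨ solve 3 (λ s t z → z := con 0ℚ :* s :+ (con 0ℚ :* t :+ z)) refl (unitDiff u w c) (unitDiff w u c) z ⟩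
          0ℚ * unitDiff u w c + (0ℚ * unitDiff w u c + z)
            ≡⟨ cong₂ (λ s t → s * unitDiff u w c + (t * unitDiff w u c + z)) (sym x≡0) (sym y≡0) ⟩
          x * unitDiff u w c + (y * unitDiff w u c + z)
            ≡⟨ rel c ⟩
          0ℚ ∎
          where z = Σℚ (λ i → μ i * p i c)

  -- Signs of edges and equality of faces

  -- A face is determined by the signs of the edges; nil marks an edge that is not tight.
  sgn : ∀ {n} → Vecℚ n × ℚ → Fin n × Fin n → Sign
  sgn (a , b) (u , w) with a u - a w ≟ b | a w - a u ≟ b
  ... | yes _ | _     = pos
  ... | no _  | yes _ = neg
  ... | no _  | no _  = nil

  -- On success of its first test `sgn` says nothing of the reverse direction. The view records
  -- both, so that one sign settles tightness in either orientation.
  data SgnView {n} (a : Vecℚ n) (b : ℚ) (u w : Fin n) : Sign → Set where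
    is-pos : a u - a w ≡ b → a w - a u ≢ b → SgnView a b u w pos
    is-neg : a u - a w ≢ b → a w - a u ≡ b → SgnView a b u w neg
    is-nil : a u - a w ≢ b → a w - a u ≢ b → SgnView a b u w nil

  tight-antisym : ∀ {b} x y → 0ℚ < b → x - y ≡ b → y - x ≢ b
  tight-antisym {b} x y 0<b xy≡b yx≡b = <⇒≢ (subst (0ℚ <_) b+b≡0 (+-mono-< 0<b 0<b)) refl
    where
    open +-*-Solver
    b+b≡0 : b + b ≡ 0ℚ
    b+b≡0 = trans (cong₂ _+_ (sym xy≡b) (sym yx≡b))
      (solve 2 (λ x y → (x :- y) :+ (y :- x) := con 0ℚ) refl x y)

  sgnView : ∀ {n} (a : Vecℚ n) {b} → 0ℚ < b → ∀ u w → SgnView a b u w (sgn (a , b) (u , w))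
  sgnView a {b} 0<b u w with a u - a w ≟ b | a w - a u ≟ b
  ... | yes p | _     = is-pos p (tight-antisym (a u) (a w) 0<b p)
  ... | no ¬p | yes q = is-neg ¬p q
  ... | no ¬p | no ¬q = is-nil ¬p ¬q

  SameTight : ∀ {n} → Vecℚ n × ℚ → Vecℚ n × ℚ → Fin n → Fin n → Set
  SameTight (a , b) (a′ , b′) u w = (a u - a w ≡ b → a′ u - a′ w ≡ b′) × (a′ u - a′ w ≡ b′ → a u - a w ≡ b)

  SgnView⇒SameTight : ∀ {n} {a a′ : Vecℚ n} {b b′ u w σ} → SgnView a b u w σ → SgnView a′ b′ u w σ →
                      SameTight (a , b) (a′ , b′) u w × SameTight (a , b) (a′ , b′) w u
  SgnView⇒SameTight (is-pos p ¬q) (is-pos p′ ¬q′) =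
    ((λ _ → p′) , (λ _ → p)) , ((λ q → ⊥-elim (¬q q)) , (λ q → ⊥-elim (¬q′ q)))
  SgnView⇒SameTight (is-neg ¬p q) (is-neg ¬p′ q′) =
    ((λ p → ⊥-elim (¬p p)) , (λ p → ⊥-elim (¬p′ p))) , ((λ _ → q′) , (λ _ → q))
  SgnView⇒SameTight (is-nil ¬p ¬q) (is-nil ¬p′ ¬q′) =
    ((λ p → ⊥-elim (¬p p)) , (λ p → ⊥-elim (¬p′ p))) , ((λ q → ⊥-elim (¬q q)) , (λ q → ⊥-elim (¬q′ q)))

  sgn⇒SameTight : ∀ {n} {f g : Vecℚ n × ℚ} → 0ℚ < proj₂ f → 0ℚ < proj₂ g → ∀ {u w} →
                  sgn f (u , w) ≡ sgn g (u , w) → SameTight f g u w × SameTight f g w u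
  sgn⇒SameTight {f = a , b} {a′ , b′} 0<b 0<b′ {u} {w} eq =
    SgnView⇒SameTight (sgnView a 0<b u w) (subst (SgnView a′ b′ u w) (sym eq) (sgnView a′ 0<b′ u w))

  SameTight⇒SameFace : ∀ {n} (H : Graph n) f g → (∀ {u w} → Adj H u w → SameTight f g u w) →
                       SameFace (sepGens H) f g
  SameTight⇒SameFace H (a , b) (a′ , b′) same x x∈ with sepGens⇒unitDiff H x∈
  ... | u , w , uw , refl = mk⇔
    (λ p → trans (dot-unitDiff a′ u w) (proj₁ (same uw) (trans (sym (dot-unitDiff a u w)) p)))
    (λ p → trans (dot-unitDiff a u w) (proj₂ (same uw) (trans (sym (dot-unitDiff a′ u w)) p)))

  -- Balance of the signs around a cycle

  infixl 7 _·_
  _·_ : ℕ → ℚ → ℚ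
  zero  · b = 0ℚ
  suc k · b = b + k · b

  0≤k·b : ∀ k {b} → 0ℚ < b → 0ℚ ≤ k · b
  0≤k·b zero    0<b = ≤-refl
  0≤k·b (suc k) 0<b = +-mono-≤ (<⇒≤ 0<b) (0≤k·b k 0<b)

  b≤[1+k]·b : ∀ k {b} → 0ℚ < b → b ≤ suc k · b
  b≤[1+k]·b k {b} 0<b = subst (_≤ suc k · b) (+-identityʳ b) (+-monoʳ-≤ b (0≤k·b k 0<b))

  -- An integer multiple of `b` strictly between `- b` and `b` is zero. The induction removes one
  -- `b` from each side until a side is exhausted.
  ·-rigid : ∀ {b ε} → 0ℚ < b → - b < ε → ε < b → ∀ p q → q · b ≡ p · b + ε → p ≡ q
  ·-rigid 0<b -b<ε ε<b zero    zero    eq = refl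
  ·-rigid {b} {ε} 0<b -b<ε ε<b zero    (suc q) eq =
    ⊥-elim (<⇒≢ (<-≤-trans ε<b (b≤[1+k]·b q 0<b)) (trans (sym (+-identityˡ ε)) (sym eq)))
  ·-rigid {b} {ε} 0<b -b<ε ε<b (suc p) zero    eq =
    ⊥-elim (<⇒≢ (≤-<-trans (neg-antimono-≤ (b≤[1+k]·b p 0<b)) -b<ε) (begin
      - (suc p · b)                  ≡⟨ +-identityʳ _ ⟨
      - (suc p · b) + 0ℚ             ≡⟨ cong (- (suc p · b) +_) eq ⟩
      - (suc p · b) + (suc p · b + ε) ≡⟨ solve 2 (λ x y → :- x :+ (x :+ y) := y) refl (suc p · b) ε ⟩
      ε ∎))
    where
    open ≡-Reasoning
    open +-*-Solver
  ·-rigid {b} {ε} 0<b -b<ε ε<b (suc p) (suc q) eq =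
    cong suc (·-rigid 0<b -b<ε ε<b p q
      (+-cancelˡ b (q · b) (p · b + ε) (trans eq (+-assoc b (p · b) ε))))
    where open import Algebra.Properties.Group +-0-group using () renaming (∙-cancelˡ to +-cancelˡ)

  drop-along : ∀ {n} → Vecℚ n → List (Fin n × Fin n) → ℚ
  drop-along a []             = 0ℚ
  drop-along a ((u , w) ∷ ps) = (a u - a w) + drop-along a ps

  module _ {n} {H : Graph n} {a : Vecℚ n} {b : ℚ} (0<b : 0ℚ < b) (bounded : Bounded H a b) where

    -- If t is the sum of the differences of a along edges with signs s, then t is
    -- (#pos s - #neg s) b up to an error ε that is smaller than b when at most one edge is nil.
    record Error (s : List Sign) (t : ℚ) : Set where
      field
        ε     : ℚ
        error : t + #neg s · b ≡ #pos s · b + ε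
        none  : #nil s ≡ 0 → ε ≡ 0ℚ
        lower : #nil s ≡ 1 → - b < ε
        upper : #nil s ≡ 1 → ε < b

    ≤∧≢⇒< : ∀ {x y} → x ≤ y → x ≢ y → x < y
    ≤∧≢⇒< x≤y x≢y = ≰⇒> (λ y≤x → x≢y (≤-antisym x≤y y≤x))

    -- A tight edge changes one of the two counts and leaves `ε` alone. A `nil` edge passes its
    -- difference to `ε`; if it is the only one, `bounded` in both directions, made strict by
    -- non-tightness, confines `ε`.
    error-∷ : ∀ {u w σ s t} → Adj H u w → SgnView a b u w σ → Error s t → Error (σ ∷ s) (a u - a w + t)
    error-∷ {u} {w} {_} {s} {t} uw (is-pos d≡b _) rec = record
      { ε = ε
      ; error = begin
          a u - a w + t + Q     ≡⟨ cong (λ z → z + t + Q) d≡b ⟩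
          b + t + Q             ≡⟨ +-assoc b t Q ⟩
          b + (t + Q)           ≡⟨ cong (b +_) error ⟩
          b + (P + ε)           ≡⟨ +-assoc b P ε ⟨
          b + P + ε             ∎
      ; none = none ; lower = lower ; upper = upper }
      where
      open ≡-Reasoning
      open Error rec
      P = #pos s · b
      Q = #neg s · b
    error-∷ {u} {w} {_} {s} {t} uw (is-neg _ d≡b) rec = record
      { ε = ε
      ; error = begin
          a u - a w + t + (b + Q)            ≡⟨ cong (λ z → a u - a w + t + (z + Q)) d≡b ⟨
          a u - a w + t + (a w - a u + Q)    ≡⟨ solve 4 (λ x y t q → x :- y :+ t :+ (y :- x :+ q) := t :+ q)
                                                  refl (a u) (a w) t Q ⟩
          t + Q                              ≡⟨ error ⟩
          P + ε                              ∎
      ; none = none ; lower = lower ; upper = upper }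
      where
      open ≡-Reasoning
      open +-*-Solver
      open Error rec
      P = #pos s · b
      Q = #neg s · b
    error-∷ {u} {w} {_} {s} {t} uw (is-nil d≢b d≢-b) rec = record
      { ε = d + ε
      ; error = begin
          d + t + Q       ≡⟨ +-assoc d t Q ⟩
          d + (t + Q)     ≡⟨ cong (d +_) error ⟩
          d + (P + ε)     ≡⟨ solve 3 (λ x y z → x :+ (y :+ z) := y :+ (x :+ z)) refl d P ε ⟩
          P + (d + ε)     ∎
      ; none = λ ()
      ; lower = λ z≡1 → subst (- b <_) (sym (d+ε≡d z≡1))
          (subst (- b <_) (-[x-y]≡y-x (a w) (a u)) (neg-antimono-< (≤∧≢⇒< (bounded (Adj-sym H uw)) d≢-b)))
      ; upper = λ z≡1 → subst (_< b) (sym (d+ε≡d z≡1)) (≤∧≢⇒< (bounded uw) d≢b) }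
      where
      open ≡-Reasoning
      open +-*-Solver
      open Error rec
      d = a u - a w
      P = #pos s · b
      Q = #neg s · b
      d+ε≡d : suc (#nil s) ≡ 1 → d + ε ≡ d
      d+ε≡d z≡1 = trans (cong (d +_) (none (cong ℕ.pred z≡1))) (+-identityʳ d)

    signs : List (Fin n × Fin n) → List Sign
    signs = map (sgn (a , b))

    signs-error : ∀ ps → All (uncurry (Adj H)) ps → Error (signs ps) (drop-along a ps)
    signs-error [] [] = record { ε = 0ℚ ; error = refl ; none = λ _ → refl ; lower = λ () ; upper = λ () }
    signs-error ((u , w) ∷ ps) (uw ∷ adj) = error-∷ uw (sgnView a 0<b u w) (signs-error ps adj)

    -- With total zero, the two multiples of `b` differ by `ε`, which is zero without `nil` and
    -- smaller than `b` in absolute value with one; `·-rigid` then equates the counts.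
    signs-balanced : ∀ ps → All (uncurry (Adj H)) ps → drop-along a ps ≡ 0ℚ →
                     #nil (signs ps) ℕ.≤ 1 → Balanced (signs ps)
    signs-balanced ps adj closed nil≤1 = nil≤1 , ·-rigid 0<b (proj₁ bounds) (proj₂ bounds) _ _ (begin
      #neg (signs ps) · b                    ≡⟨ +-identityˡ _ ⟨
      0ℚ + #neg (signs ps) · b               ≡⟨ cong (_+ #neg (signs ps) · b) closed ⟨
      drop-along a ps + #neg (signs ps) · b  ≡⟨ error ⟩
      #pos (signs ps) · b + ε                ∎)
      where
      open ≡-Reasoning
      open Error (signs-error ps adj)
      bounds : - b < ε × ε < b
      bounds with ℕ.m≤n⇒m<n∨m≡n nil≤1
      ... | inj₂ nil≡1 = lower nil≡1 , upper nil≡1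
      ... | inj₁ nil<1 = subst (λ z → - b < z × z < b) (sym (none (ℕ.n<1⇒n≡0 nil<1)))
                           (neg-antimono-< 0<b , 0<b)

open Facets

open import Data.Nat using (_≤_; _+_; _*_; _^_; _∸_)
open import Data.Nat.Properties
  using (≤-refl; ≤-trans; ≤-reflexive; +-suc; m≤n⇒m≤1+n; *-mono-≤; ^-distribˡ-+-*; ^-monoʳ-≤; m+[n∸m]≡n;
         m≤m+n; <-asym; module ≤-Reasoning)

AllPairs-map-∈ : ∀ {A : Set} {R S : A → A → Set} {xs} → (∀ {x y} → x ∈ xs → y ∈ xs → R x y → S x y) →
                 AllPairs R xs → AllPairs S xs
AllPairs-map-∈ f []         = []
AllPairs-map-∈ f (rx ∷ rxs) =
  All.tabulate (λ y∈ → f (here refl) (there y∈) (All.lookup rx y∈))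
  ∷ AllPairs-map-∈ (λ x∈ y∈ → f (there x∈) (there y∈)) rxs

#nil≡0 : ∀ {A : Set} {σ : A → Sign} {xs} → All (λ x → σ x ≢ nil) xs → #nil (map σ xs) ≡ 0
#nil≡0 [] = refl
#nil≡0 {σ = σ} {x ∷ _} (σx≢nil ∷ rest) with σ x
... | pos = #nil≡0 rest
... | neg = #nil≡0 rest
... | nil = ⊥-elim (σx≢nil refl)

#nil≤1 : ∀ {A : Set} {σ : A → Sign} {xs} → AllPairs (λ x y → σ x ≡ nil → σ y ≢ nil) xs →
         #nil (map σ xs) ≤ 1
#nil≤1 [] = z≤n
#nil≤1 {σ = σ} {x ∷ _} (σx ∷ rest) with σ x
... | pos = #nil≤1 rest
... | neg = #nil≤1 rest
... | nil = s≤s (≤-reflexive (#nil≡0 (All.map (λ h → h refl) σx)))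

-- Colourings and functions constant along few edges

Constant : ∀ {n} {A : Set} → (Fin n → A) → Fin n × Fin n → Set
Constant f (u , w) = f u ≡ f w

-- Merging the end colours of each edge in turn loses at most one colour per edge.
record Colouring {n} (L : List (Fin n × Fin n)) : Set where
  field
    k          : ℕ
    colour     : Fin n → Fin k
    surjective : ∀ j → ∃ λ v → colour v ≡ j
    constant   : All (Constant colour) L
    many       : n ≤ k + length L

-- The colour `c u` is punched out of `Fin (suc k)` and its class joins that of `c w`. Every other
-- colour is still attained, which preserves surjectivity.
mergeColours : ∀ {n k} (c : Fin n → Fin (suc k)) {u w} → c u ≢ c w → ∃ λ (c′ : Fin n → Fin k) →
               (∀ {x y} → c x ≡ c y → c′ x ≡ c′ y) × c′ u ≡ c′ w ×
               ((∀ j → ∃ λ v → c v ≡ j) → ∀ j → ∃ λ v → c′ v ≡ j)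
mergeColours {k = k} c {u} {w} cu≢cw = (λ v → m (c v)) , cong m , eq , surj
  where
  m : Fin (suc k) → Fin k
  m j with c u ≟F j
  ... | yes _   = punchOut cu≢cw
  ... | no cu≢j = punchOut cu≢j
  eq : m (c u) ≡ m (c w)
  eq with c u ≟F c u | c u ≟F c w
  ... | _       | yes cu≡cw = ⊥-elim (cu≢cw cu≡cw)
  ... | no ¬eq  | no _      = ⊥-elim (¬eq refl)
  ... | yes _   | no _      = punchOut-cong (c u) refl
  m-punchIn : ∀ j → m (punchIn (c u) j) ≡ j
  m-punchIn j with c u ≟F punchIn (c u) j
  ... | yes e = ⊥-elim (punchInᵢ≢i (c u) j (sym e))
  ... | no ¬e = trans (punchOut-cong (c u) refl) (punchOut-punchIn (c u))
  surj : (∀ j → ∃ λ v → c v ≡ j) → ∀ j → ∃ λ v → m (c v) ≡ j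
  surj c-surj j = let v , cv≡ = c-surj (punchIn (c u) j) in v , trans (cong m cv≡) (m-punchIn j)

colouring : ∀ {n} (L : List (Fin n × Fin n)) → Colouring L
colouring {n} [] = record
  { k = n ; colour = id ; surjective = λ j → j , refl ; constant = [] ; many = ℕ.m≤m+n n 0 }
colouring ((u , w) ∷ L) with colouring L
... | record { k = zero ; colour = c } with () ← c u
... | record { k = suc k ; colour = c ; surjective = surj ; constant = const ; many = many }
  with c u ≟F c w
... | yes cu≡cw = record
  { k = suc k ; colour = c ; surjective = surj ; constant = cu≡cw ∷ const
  ; many = ≤-trans many (ℕ.+-monoʳ-≤ (suc k) (ℕ.n≤1+n (length L))) }
... | no cu≢cw with mergeColours c cu≢cw
... | c′ , coarser , c′u≡c′w , surj′ = record
  { k = k ; colour = c′ ; surjective = surj′ surj ; constant = c′u≡c′w ∷ All.map coarser const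
  ; many = ≤-trans many (≤-reflexive (sym (+-suc k (length L)))) }

0≢1 : 0ℚ ≢ 1ℚ
0≢1 ()

-- The count in `Colouring` leaves at least two colours, and `f` separates colour zero from the
-- others.
fewEdges⇒nonconstant : ∀ {n} (L : List (Fin n × Fin n)) → 2 + length L ≤ n →
                       ∃ λ (f : Vecℚ n) → All (Constant f) L × (∃₂ λ u w → f u ≢ f w)
fewEdges⇒nonconstant {n} L few with colouring L
... | record { k = 0 ; many = many } = ⊥-elim (ℕ.1+n≰n (≤-trans (≤-trans (m≤n⇒m≤1+n ≤-refl) few) many))
... | record { k = 1 ; many = many } = ⊥-elim (ℕ.1+n≰n (≤-trans few many))
... | record { k = suc (suc k) ; colour = c ; surjective = surj ; constant = const } =
  (λ v → level (c v)) , All.map (cong level) const ,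
  proj₁ (surj zero) , proj₁ (surj (suc zero)) ,
  (λ eq → 0≢1 (trans (sym (cong level (proj₂ (surj zero)))) (trans eq (cong level (proj₂ (surj (suc zero)))))))
  where
  level : Fin (suc (suc k)) → ℚ
  level zero    = 0ℚ
  level (suc _) = 1ℚ

-- Cycles and their undirected edges

-- Mirrors the unfolding of cycPairs, whose recursive helper is private.
closing : ∀ {A : Set} → A → A → List A → List (A × A)
closing f x []       = (x , f) ∷ []
closing f x (y ∷ ys) = (x , y) ∷ closing f y ys

cycPairs-closing : ∀ {A : Set} (x : A) xs → cycPairs (x ∷ xs) ≡ closing x x xs
cycPairs-closing x []       = refl
cycPairs-closing x (y ∷ ys) = cong ((x , y) ∷_) (tail x y ys)
  where
  tail : ∀ f y ys → drop 1 (cycPairs (f ∷ y ∷ ys)) ≡ closing f y ys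
  tail f y []       = refl
  tail f y (z ∷ zs) = cong ((y , z) ∷_) (tail f z zs)

length-closing : ∀ {A : Set} (f x : A) xs → length (closing f x xs) ≡ suc (length xs)
length-closing f x []       = refl
length-closing f x (y ∷ ys) = cong suc (length-closing f y ys)

closing-constant : ∀ {n} (g : Vecℚ n) f x xs → All (Constant g) (closing f x xs) → g x ≡ g f
closing-constant g f x []       (gx≡gf ∷ []) = gx≡gf
closing-constant g f x (y ∷ ys) (gx≡gy ∷ gs) = trans gx≡gy (closing-constant g f y ys gs)

drop-along-closing : ∀ {n} (a : Vecℚ n) f x xs → drop-along a (closing f x xs) ≡ a x ℚ.- a f
drop-along-closing a f x []       = ℚ.+-identityʳ _
drop-along-closing a f x (y ∷ ys) = trans (cong ((a x ℚ.- a y) ℚ.+_) (drop-along-closing a f y ys))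
  (solve 3 (λ x y z → x :- y :+ (y :- z) := x :- z) refl (a x) (a y) (a f))
  where open +-*-Solver

closing-∈ˡ : ∀ {A : Set} (f x : A) xs {u w} → (u , w) ∈ closing f x xs → u ∈ x ∷ xs
closing-∈ˡ f x []       (here refl) = here refl
closing-∈ˡ f x (y ∷ ys) (here refl) = here refl
closing-∈ˡ f x (y ∷ ys) (there uw)  = there (closing-∈ˡ f y ys uw)

closing-∈ʳ : ∀ {A : Set} (f x : A) xs {u w} → (u , w) ∈ closing f x xs → w ∈ xs ⊎ w ≡ f
closing-∈ʳ f x []       (here refl) = inj₂ refl
closing-∈ʳ f x (y ∷ ys) (here refl) = inj₁ (here refl)
closing-∈ʳ f x (y ∷ ys) (there uw) with closing-∈ʳ f y ys uw
... | inj₁ w∈ys = inj₁ (there w∈ys)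
... | inj₂ w≡f  = inj₂ w≡f

_≁_ : ∀ {A : Set} → A × A → A × A → Set
p ≁ q = p ≢ q × p ≢ swap q

-- Here `f` lies off the path, so this treats the walk around a cycle from its second vertex on;
-- `cycPairs-≁` adds the first pair.
closing-≁ : ∀ {A : Set} (f x : A) xs → Unique (x ∷ xs) → f ∉ x ∷ xs → AllPairs _≁_ (closing f x xs)
closing-≁ f x []       _                     _  = [] ∷ []
closing-≁ f x (y ∷ ys) (x∉ ∷ xs!) f∉ = All.tabulate fresh ∷ closing-≁ f y ys xs! (f∉ ∘ there)
  where
  fresh : ∀ {q} → q ∈ closing f y ys → (x , y) ≁ q
  fresh q∈ = (λ { refl → All.lookup x∉ (closing-∈ˡ f y ys q∈) refl }) , λ { refl → reversed q∈ }
    where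
    reversed : (y , x) ∉ closing f y ys
    reversed yx∈ with closing-∈ʳ f y ys yx∈
    ... | inj₁ x∈ys = All.lookup x∉ (there x∈ys) refl
    ... | inj₂ x≡f  = f∉ (here (sym x≡f))

cycPairs-≁ : ∀ {A : Set} (xs : List A) → 3 ≤ length xs → Unique xs → AllPairs _≁_ (cycPairs xs)
cycPairs-≁ (x ∷ [])         (s≤s ())       _
cycPairs-≁ (x ∷ y ∷ [])     (s≤s (s≤s ())) _
cycPairs-≁ (x ∷ y ∷ z ∷ zs) _ ((x≢y ∷ x≢z ∷ x∉zs) ∷ ys!@(y∉ ∷ _)) =
  subst (AllPairs _≁_) (sym (cycPairs-closing x (y ∷ z ∷ zs)))
    (All.tabulate fresh ∷ closing-≁ x y (z ∷ zs) ys! (λ x∈ → All.lookup (x≢y ∷ x≢z ∷ x∉zs) x∈ refl))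
  where
  fresh : ∀ {q} → q ∈ closing x y (z ∷ zs) → (x , y) ≁ q
  fresh q∈ = (λ { refl → All.lookup (x≢y ∷ x≢z ∷ x∉zs) (closing-∈ˡ x y (z ∷ zs) q∈) refl })
           , λ { refl → reversed q∈ }
    where
    reversed : (y , x) ∉ closing x y (z ∷ zs)
    -- This is where length at least 3 enters: a cycle on two vertices would traverse its edge in
    -- both directions.
    reversed (here refl)  = x≢z refl
    reversed (there yx∈) = All.lookup y∉ (closing-∈ˡ x z zs yx∈) refl

-- Orients a pair as `ordered` demands, so that undirected edges can be compared by propositional
-- equality.
norm : ∀ {n} → Fin n × Fin n → Fin n × Fin n
norm (u , w) with toℕ u ℕ.<? toℕ w
... | yes _ = u , w
... | no  _ = w , u

norm-cases : ∀ {n} (p : Fin n × Fin n) → norm p ≡ p ⊎ norm p ≡ swap p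
norm-cases (u , w) with toℕ u ℕ.<? toℕ w
... | yes _ = inj₁ refl
... | no  _ = inj₂ refl

norm-injective : ∀ {n} {p q : Fin n × Fin n} → norm p ≡ norm q → p ≡ q ⊎ p ≡ swap q
norm-injective {p = p} {q} eq with norm-cases p | norm-cases q
... | inj₁ p≡ | inj₁ q≡ = inj₁ (trans (sym p≡) (trans eq q≡))
... | inj₁ p≡ | inj₂ q≡ = inj₂ (trans (sym p≡) (trans eq q≡))
... | inj₂ p≡ | inj₁ q≡ = inj₂ (cong swap (trans (sym p≡) (trans eq q≡)))
... | inj₂ p≡ | inj₂ q≡ = inj₁ (cong swap (trans (sym p≡) (trans eq q≡)))

≁⇒norm≢ : ∀ {n} {p q : Fin n × Fin n} → p ≁ q → norm p ≢ norm q
≁⇒norm≢ (p≢q , p≢swap) eq with norm-injective eq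
... | inj₁ p≡q    = p≢q p≡q
... | inj₂ p≡swap = p≢swap p≡swap

Constant-norm : ∀ {n} {g : Vecℚ n} p → Constant g (norm p) → Constant g p
Constant-norm {g = g} p c with norm-cases p
... | inj₁ eq = subst (Constant g) eq c
... | inj₂ eq = sym (subst (Constant g) eq c)

norm-Constant : ∀ {n} {g : Vecℚ n} p → Constant g p → Constant g (norm p)
norm-Constant {g = g} p c with norm-cases p
... | inj₁ eq = subst (Constant g) (sym eq) c
... | inj₂ eq = subst (Constant g) (sym eq) (sym c)

-- e is a combination of the other edges in es, expressed dually.
Closes : ∀ {n} → List (Fin n × Fin n) → Fin n × Fin n → Set
Closes {n} es e = ∀ (g : Vecℚ n) → (∀ {e′} → e′ ∈ es → e′ ≢ e → Constant g e′) → Constant g e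

-- The first edge serves: the other pairs form a path between its ends along which `g` is constant,
-- and by `cycPairs-≁` none of them is that edge again.
cycPairs-closes : ∀ {n} (xs : List (Fin n)) → 3 ≤ length xs → Unique xs →
                  ∃ λ e → e ∈ map norm (cycPairs xs) × Closes (map norm (cycPairs xs)) e
cycPairs-closes (x ∷ [])     (s≤s ()) _
cycPairs-closes (x ∷ y ∷ ys) lg xs! =
  subst (λ ps → ∃ λ e → e ∈ map norm ps × Closes (map norm ps) e) (sym unfold)
    (norm (x , y) , here refl , λ g const → norm-Constant {g = g} (x , y) (sym (closing-constant g x y ys
      (All.tabulate (λ {p} p∈ → Constant-norm {g = g} p (const (there (∈-map⁺ norm p∈))
        (λ eq → ≁⇒norm≢ (All.lookup head≁ p∈) (sym eq))))))))
  where
  unfold : cycPairs (x ∷ y ∷ ys) ≡ (x , y) ∷ closing x y ys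
  unfold = cycPairs-closing x (y ∷ ys)
  head≁ : All ((x , y) ≁_) (closing x y ys)
  head≁ = AllPairs.head (subst (AllPairs _≁_) unfold (cycPairs-≁ (x ∷ y ∷ ys) lg xs!))

norm∈edges : ∀ {n} (H : Graph n) {u w} → Adj H u w → norm (u , w) ∈ edges H
norm∈edges H {u} {w} (inj₁ e∈) with toℕ u ℕ.<? toℕ w
... | yes _  = e∈
... | no u≮w = ⊥-elim (u≮w (All.lookup (ordered H) e∈))
norm∈edges H {u} {w} (inj₂ e∈) with toℕ u ℕ.<? toℕ w
... | yes u<w = ⊥-elim (<-asym u<w (All.lookup (ordered H) e∈))
... | no _    = e∈

module _ {n} {H : Graph n} (C : Cycle H) where

  cycleEdges : List (Fin n × Fin n)
  cycleEdges = map norm (cycPairs (verts C))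

  cycleEdges-! : Unique cycleEdges
  cycleEdges-! = AllPairs.map⁺ (AllPairs.map ≁⇒norm≢ (cycPairs-≁ (verts C) (long C) (distinct C)))

  cycleEdges⊆edges : ∀ {e} → e ∈ cycleEdges → e ∈ edges H
  cycleEdges⊆edges e∈ with ∈-map⁻ norm e∈
  ... | p , p∈ , refl = norm∈edges H (All.lookup (closed C) p∈)

  length-cycPairs : length (cycPairs (verts C)) ≡ length (verts C)
  length-cycPairs with verts C
  ... | []     = refl
  ... | x ∷ xs = trans (cong length (cycPairs-closing x xs)) (length-closing x x xs)

  length-cycleEdges : length cycleEdges ≡ length (verts C)
  length-cycleEdges = trans (length-map norm (cycPairs (verts C))) length-cycPairs

  drop-along-cycle : ∀ a → drop-along a (cycPairs (verts C)) ≡ 0ℚ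
  drop-along-cycle a with verts C
  ... | []     = refl
  ... | x ∷ xs = trans (cong (drop-along a) (cycPairs-closing x xs))
                       (trans (drop-along-closing a x x xs) (ℚ.+-inverseʳ (a x)))

  closingEdge : ∃ λ e → e ∈ cycleEdges × Closes cycleEdges e
  closingEdge = cycPairs-closes (verts C) (long C) (distinct C)

length-cartesianProduct : ∀ {A B : Set} (xs : List A) (ys : List B) →
                          length (cartesianProduct xs ys) ≡ length xs * length ys
length-cartesianProduct []       ys = refl
length-cartesianProduct (x ∷ xs) ys = trans (length-++ (map (x ,_) ys))
  (cong₂ _+_ (length-map (x ,_) ys) (length-cartesianProduct xs ys))

EdgeDisjoint⇒Disjoint : ∀ {n} {H : Graph n} (C D : Cycle H) → EdgeDisjoint C D →
                        Disjoint (cycleEdges C) (cycleEdges D)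
EdgeDisjoint⇒Disjoint C D disj (e∈C , e∈D) with ∈-map⁻ norm e∈C | ∈-map⁻ norm e∈D
... | (u , w) , p∈ , refl | q , q∈ , eq with norm-injective eq
... | inj₁ refl = disj u w (inj₁ p∈) (inj₁ q∈)
... | inj₂ refl = disj u w (inj₁ p∈) (inj₂ q∈)

_∈E?_ : ∀ {n} (e : Fin n × Fin n) es → Dec (e ∈ es)
_∈E?_ = DecMembership._∈?_
  where module DecMembership {n} = Data.List.Membership.DecPropositional (≡-dec (_≟F_ {n}) (_≟F_ {n}))

_∖_ : ∀ {n} → List (Fin n × Fin n) → List (Fin n × Fin n) → List (Fin n × Fin n)
E ∖ X = filter (λ e → ¬? (e ∈E? X)) E

length-∖ : ∀ {n} {E X : List (Fin n × Fin n)} → Unique E → Unique X → (∀ {e} → e ∈ X → e ∈ E) →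
           length X + length (E ∖ X) ≤ length E
length-∖ {E = E} {X} E! X! X⊆E = subst (_≤ length E) (length-++ X)
  (Unique⇒length≤ (Unique.++⁺ X! (Unique.filter⁺ ∉X? E!) disjoint) sub)
  where
  ∉X? = λ e → ¬? (e ∈E? X)
  disjoint : Disjoint X (E ∖ X)
  disjoint (e∈X , e∈∖) = proj₂ (∈-filter⁻ ∉X? {xs = E} e∈∖) e∈X
  sub : ∀ {e} → e ∈ X ++ (E ∖ X) → e ∈ E
  sub e∈ with ∈-++⁻ X e∈
  ... | inj₁ e∈X = X⊆E e∈X
  ... | inj₂ e∈∖ = proj₁ (∈-filter⁻ ∉X? e∈∖)

-- Reversal exchanges `pos` and `neg` but fixes `nil`. This links signs read along a cycle to edges
-- as they are stored.
sgn-norm : ∀ {n} {a : Vecℚ n} {b} → 0ℚ ℚ.< b → ∀ p → sgn (a , b) p ≡ nil → sgn (a , b) (norm p) ≡ nil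
sgn-norm {a = a} {b} 0<b (u , w) eq with norm-cases (u , w)
... | inj₁ n≡ = trans (cong (sgn (a , b)) n≡) eq
... | inj₂ n≡ = trans (cong (sgn (a , b)) n≡)
  (flip-nil (subst (SgnView a b u w) eq (sgnView a 0<b u w)) (sgnView a 0<b w u))
  where
  flip-nil : ∀ {σ} → SgnView a b u w nil → SgnView a b w u σ → σ ≡ nil
  flip-nil (is-nil ¬p ¬q) (is-pos q _) = ⊥-elim (¬q q)
  flip-nil (is-nil ¬p ¬q) (is-neg _ p) = ⊥-elim (¬p p)
  flip-nil (is-nil ¬p ¬q) (is-nil _ _) = refl

Reach-constant : ∀ {n} {H : Graph n} (g : Vecℚ n) → (∀ {u w} → Adj H u w → g u ≡ g w) →
                 ∀ {u w} → Reach H u w → g u ≡ g w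
Reach-constant g const here          = refl
Reach-constant g const (step uv v⇝w) = trans (const uv) (Reach-constant g const v⇝w)

-- Which edges of a facet can fail to be tight

module _ {n} (H : Graph n) (connected : Connected H) (size : numEdges H ≡ suc n)
         {a : Vecℚ n} {b : ℚ} (0<b : 0ℚ ℚ.< b) (rigid : Rigid H a b) where

  σ : Fin n × Fin n → Sign
  σ = sgn (a , b)

  -- Rigidity makes `g` constant along every edge, and connectedness then makes it constant. A
  -- stored edge with a sign other than `nil` accounts for tightness in either direction.
  rigid-sgn : ∀ g → (∀ {e} → e ∈ edges H → σ e ≢ nil → Constant g e) → ∀ u w → g u ≡ g w
  rigid-sgn g const u w = Reach-constant g (rigid g tight⇒const) (connected u w)
    where
    not-nil : ∀ {u w σ} → SgnView a b u w σ → a u ℚ.- a w ≡ b ⊎ a w ℚ.- a u ≡ b → σ ≢ nil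
    not-nil (is-nil ¬p ¬q) (inj₁ p) refl = ¬p p
    not-nil (is-nil ¬p ¬q) (inj₂ q) refl = ¬q q
    tight⇒const : ∀ {u w} → Adj H u w → a u ℚ.- a w ≡ b → g u ≡ g w
    tight⇒const {u} {w} (inj₁ e∈) p = const e∈ (not-nil (sgnView a 0<b u w) (inj₁ p))
    tight⇒const {u} {w} (inj₂ e∈) p = sym (const e∈ (not-nil (sgnView a 0<b w u) (inj₂ p)))

  -- Deleting three edges from H leaves too few edges to connect it.
  no-three : ∀ X → length X ≡ 3 → Unique X → (∀ {e} → e ∈ X → e ∈ edges H) →
             ¬ (∀ (g : Vecℚ n) → (∀ {e} → e ∈ edges H → e ∉ X → Constant g e) →
                ∀ {e} → e ∈ X → σ e ≢ nil → Constant g e)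
  no-three X |X|≡3 X! X⊆E closes with fewEdges⇒nonconstant (edges H ∖ X) few
    where
    -- The `n + 1` edges of `H` include the three in `X`, so at most `n - 2` are left.
    few : 2 + length (edges H ∖ X) ≤ n
    few = ℕ.s≤s⁻¹ (subst₂ (λ k m → k + length (edges H ∖ X) ≤ m) |X|≡3 size (length-∖ (nodup H) X! X⊆E))
  -- By `closes`, the tight edges in `X` put no constraint on `g` beyond those from outside `X`, so
  -- `g` refutes rigidity.
  ... | g , const , u , w , gu≢gw = gu≢gw (rigid-sgn g const-on-tight u w)
    where
    outside : ∀ {e} → e ∈ edges H → e ∉ X → Constant g e
    outside e∈ e∉X = All.lookup const (∈-filter⁺ (λ e → ¬? (e ∈E? X)) e∈ e∉X)
    const-on-tight : ∀ {e} → e ∈ edges H → σ e ≢ nil → Constant g e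
    const-on-tight {e} e∈ σe≢nil with e ∈E? X
    ... | yes e∈X = closes g outside e∈X σe≢nil
    ... | no  e∉X = outside e∈ e∉X

  -- Two `nil` edges of `C` and a closing edge of `D` would contradict `no-three`: the first two are
  -- not tight, and the third is tied to the rest of `D`, which avoids the deleted edges.
  cycle-#nil≤1 : (C D : Cycle H) → Disjoint (cycleEdges C) (cycleEdges D) →
                 #nil (map σ (cycPairs (verts C))) ≤ 1
  cycle-#nil≤1 C D disj = #nil≤1 (AllPairs-map-∈ two-nil (cycPairs-≁ (verts C) (long C) (distinct C)))
    where
    d   = proj₁ (closingEdge D)
    d∈D = proj₁ (proj₂ (closingEdge D))
    two-nil : ∀ {p q} → p ∈ cycPairs (verts C) → q ∈ cycPairs (verts C) → p ≁ q → σ p ≡ nil → σ q ≢ nil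
    two-nil {p} {q} p∈ q∈ p≁q σp σq = no-three X refl X! X⊆E closes
      where
      p∈C = ∈-map⁺ norm p∈
      q∈C = ∈-map⁺ norm q∈
      X = norm p ∷ norm q ∷ d ∷ []
      C≢D : ∀ {e e′} → e ∈ cycleEdges C → e′ ∈ cycleEdges D → e ≢ e′
      C≢D e∈C e∈D refl = disj (e∈C , e∈D)
      X! : Unique X
      X! = (≁⇒norm≢ p≁q ∷ C≢D p∈C d∈D ∷ []) ∷ (C≢D q∈C d∈D ∷ []) ∷ [] ∷ []
      X⊆E : ∀ {e} → e ∈ X → e ∈ edges H
      X⊆E (here refl)                 = cycleEdges⊆edges C p∈C
      X⊆E (there (here refl))         = cycleEdges⊆edges C q∈C
      X⊆E (there (there (here refl))) = cycleEdges⊆edges D d∈D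
      closes : ∀ (g : Vecℚ n) → (∀ {e} → e ∈ edges H → e ∉ X → Constant g e) →
               ∀ {e} → e ∈ X → σ e ≢ nil → Constant g e
      closes g out (here refl)                 σ≢ = ⊥-elim (σ≢ (sgn-norm 0<b p σp))
      closes g out (there (here refl))         σ≢ = ⊥-elim (σ≢ (sgn-norm 0<b q σq))
      closes g out (there (there (here refl))) _  = proj₂ (proj₂ (closingEdge D)) g (λ e∈D e≢d →
        out (cycleEdges⊆edges D e∈D) λ where
          (here refl)                 → disj (p∈C , e∈D)
          (there (here refl))         → disj (q∈C , e∈D)
          (there (there (here refl))) → e≢d refl)

  -- Here the three deleted edges are `e` and one closing edge of each cycle; each closing edge is
  -- tied to the rest of its own cycle.
  off-cycles-tight : (C D : Cycle H) → Disjoint (cycleEdges C) (cycleEdges D) →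
                     ∀ {e} → e ∈ edges H → e ∉ cycleEdges C ++ cycleEdges D → σ e ≢ nil
  off-cycles-tight C D disj {e} e∈ e∉ σe = no-three X refl X! X⊆E closes
    where
    c   = proj₁ (closingEdge C)
    c∈C = proj₁ (proj₂ (closingEdge C))
    d   = proj₁ (closingEdge D)
    d∈D = proj₁ (proj₂ (closingEdge D))
    e∉C : e ∉ cycleEdges C
    e∉C = e∉ ∘ ∈-++⁺ˡ
    e∉D : e ∉ cycleEdges D
    e∉D = e∉ ∘ ∈-++⁺ʳ (cycleEdges C)
    X = e ∷ c ∷ d ∷ []
    X! : Unique X
    X! = ((λ { refl → e∉C c∈C }) ∷ (λ { refl → e∉D d∈D }) ∷ [])
       ∷ ((λ c≡d → disj (c∈C , subst (_∈ cycleEdges D) (sym c≡d) d∈D)) ∷ []) ∷ [] ∷ []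
    X⊆E : ∀ {e} → e ∈ X → e ∈ edges H
    X⊆E (here refl)                 = e∈
    X⊆E (there (here refl))         = cycleEdges⊆edges C c∈C
    X⊆E (there (there (here refl))) = cycleEdges⊆edges D d∈D
    closes : ∀ (g : Vecℚ n) → (∀ {e} → e ∈ edges H → e ∉ X → Constant g e) →
             ∀ {e} → e ∈ X → σ e ≢ nil → Constant g e
    closes g out (here refl)         σ≢ = ⊥-elim (σ≢ σe)
    closes g out (there (here refl)) _  = proj₂ (proj₂ (closingEdge C)) g (λ e∈C e≢c →
      out (cycleEdges⊆edges C e∈C) λ where
        (here refl)                 → e∉C e∈C
        (there (here refl))         → e≢c refl
        (there (there (here refl))) → disj (e∈C , d∈D))
    closes g out (there (there (here refl))) _ = proj₂ (proj₂ (closingEdge D)) g (λ e∈D e≢d →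
      out (cycleEdges⊆edges D e∈D) λ where
        (here refl)                 → e∉D e∈D
        (there (here refl))         → disj (c∈C , e∈D)
        (there (there (here refl))) → e≢d refl)

-- Counting the facets

count-bound : ∀ n (r r₁ i r₂ j : ℕ) → (r₁ + suc (i + i)) + (r₂ + suc (j + j)) + r ≤ suc n →
              (2 ^ r₁ * G i) * ((2 ^ r₂ * G j) * 2 ^ r) ≤ M n
count-bound n r r₁ i r₂ j bound = begin
  (2 ^ r₁ * G i) * ((2 ^ r₂ * G j) * 2 ^ r)   ≡⟨ regroup (2 ^ r₁) (G i) (2 ^ r₂) (G j) (2 ^ r) ⟩
  2 ^ r₁ * 2 ^ r₂ * 2 ^ r * (G i * G j)       ≡⟨ cong (λ z → z * 2 ^ r * (G i * G j)) (^-distribˡ-+-* 2 r₁ r₂) ⟨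
  2 ^ (r₁ + r₂) * 2 ^ r * (G i * G j)         ≡⟨ cong (_* (G i * G j)) (^-distribˡ-+-* 2 (r₁ + r₂) r) ⟨
  2 ^ R * (G i * G j)                         ≤⟨ *-mono-≤ (^-monoʳ-≤ 2 (m≤m+n R δ)) (GG≤Modd i j) ⟩
  2 ^ (R + δ) * Modd (suc (i + j))            ≤⟨ 2^r*Modd≤M (R + δ) (i + j) ⟩
  M (suc (R + δ + ((i + j) + (i + j))))       ≡⟨ cong M n≡ ⟩
  M n                                         ∎
  where
  open ≤-Reasoning
  R = r₁ + r₂ + r
  total = suc (R + ((i + j) + (i + j)))
  -- Slack in the edge count is treated as extra bridges, which only enlarges the product.
  δ = n ∸ total
  regroup : ∀ x g y h z → (x * g) * ((y * h) * z) ≡ x * y * z * (g * h)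
  regroup = solve-∀
  sum-total : ∀ r r₁ i r₂ j → (r₁ + suc (i + i)) + (r₂ + suc (j + j)) + r
                              ≡ suc (suc (r₁ + r₂ + r + ((i + j) + (i + j))))
  sum-total = solve-∀
  swap-δ : ∀ R δ s → suc (R + δ + s) ≡ suc (R + s) + δ
  swap-δ = solve-∀
  n≡ : suc (R + δ + ((i + j) + (i + j))) ≡ n
  n≡ = trans (swap-δ R δ ((i + j) + (i + j)))
    (m+[n∸m]≡n (ℕ.s≤s⁻¹ (subst (_≤ suc n) (sum-total r r₁ i r₂ j) bound)))

theorem3p4 : (n : ℕ) → 3 ≤ n → (H : Graph n) → Connected H →
    numEdges H ≡ suc n → HasTwoEdgeDisjointCycles H → SEPFacets≤ H (M n)
theorem3p4 n _ H connected size (C , D , edgeDisjoint) fs facets distinctFaces = begin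
  length fs
    ≡⟨ length-map code fs ⟨
  length (map code fs)
    ≤⟨ Unique⇒length≤ codes! codes⊆ ⟩
  length (cartesianProduct (codes BC) (cartesianProduct (codes BD) (allWords (length rest))))
    ≡⟨ trans (length-cartesianProduct (codes BC) _) (cong (length (codes BC) *_) (length-cartesianProduct (codes BD) _)) ⟩
  length (codes BC) * (length (codes BD) * length (allWords (length rest)))
    ≤⟨ *-mono-≤ (length-codes BC) (*-mono-≤ (length-codes BD) (≤-reflexive (length-allWords (length rest)))) ⟩
  (2 ^ bridges BC * G (half BC)) * ((2 ^ bridges BD * G (half BD)) * 2 ^ length rest)
    ≤⟨ count-bound n (length rest) (bridges BC) (half BC) (bridges BD) (half BD) edge-count ⟩
  M n ∎
  where
  open ≤-Reasoning
  open BalancedCodes renaming (size to codes-size)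
  onCycles = cycleEdges C ++ cycleEdges D
  rest = edges H ∖ onCycles
  disjoint : Disjoint (cycleEdges C) (cycleEdges D)
  disjoint = EdgeDisjoint⇒Disjoint C D edgeDisjoint
  BC = balancedCodes (length (verts C)) (long C)
  BD = balancedCodes (length (verts D)) (long D)

  edge-count : (bridges BC + suc (half BC + half BC)) + (bridges BD + suc (half BD + half BD)) + length rest ≤ suc n
  edge-count = subst₂ _≤_ (cong (_+ length rest) (trans (length-++ (cycleEdges C))
      (cong₂ _+_ (trans (length-cycleEdges C) (sym (codes-size BC)))
                 (trans (length-cycleEdges D) (sym (codes-size BD)))))) size
    (length-∖ (nodup H) (Unique.++⁺ (cycleEdges-! C) (cycleEdges-! D) disjoint) sub)
    where
    sub : ∀ {e} → e ∈ onCycles → e ∈ edges H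
    sub e∈ with ∈-++⁻ (cycleEdges C) e∈
    ... | inj₁ e∈C = cycleEdges⊆edges C e∈C
    ... | inj₂ e∈D = cycleEdges⊆edges D e∈D

  -- The cycles are read in their direction of travel, as balance requires; the other edges are read
  -- as stored.
  code : Vecℚ n × ℚ → List Sign × List Sign × List Sign
  code f = map (sgn f) (cycPairs (verts C)) , map (sgn f) (cycPairs (verts D)) , map (sgn f) rest

  -- `facet⇒0<b` asks for an edge; the first one of `C` is taken.
  adjacent : ∃₂ (Adj H)
  adjacent with cycPairs (verts C) | closed C | length-cycPairs C | long C
  ... | p ∷ _ | uw ∷ _ | _ | _ = _ , _ , uw
  ... | [] | _ | eq | 3≤ with () ← subst (3 ≤_) (sym eq) 3≤

  positive : ∀ {f} → f ∈ fs → 0ℚ ℚ.< proj₂ f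
  positive {a , b} f∈ = facet⇒0<b H {a = a} (proj₂ (proj₂ adjacent)) (All.lookup facets f∈)

  codes⊆ : ∀ {c} → c ∈ map code fs →
           c ∈ cartesianProduct (codes BC) (cartesianProduct (codes BD) (allWords (length rest)))
  codes⊆ c∈ with ∈-map⁻ code c∈
  ... | (a , b) , f∈ , refl =
    ∈-cartesianProduct⁺ (cycle-code C D disjoint BC) (∈-cartesianProduct⁺
      (cycle-code D C (λ (e∈D , e∈C) → disjoint (e∈C , e∈D)) BD)
      (subst (λ m → map (sgn (a , b)) rest ∈ allWords m) (length-map (sgn (a , b)) rest)
        (∈-allWords _ (#nil≡0 (All.tabulate rest-tight)))))
    where
    facet = All.lookup facets f∈
    0<b = positive f∈
    rigid : Rigid H a b
    rigid = facet⇒Rigid H {a} 0<b facet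
    rest-tight : ∀ {e} → e ∈ rest → sgn (a , b) e ≢ nil
    rest-tight e∈ = let e∈E , e∉ = ∈-filter⁻ (λ e → ¬? (e ∈E? onCycles)) {xs = edges H} e∈
                    in off-cycles-tight H connected size 0<b rigid C D disjoint e∈E e∉
    cycle-code : (C D : Cycle H) → Disjoint (cycleEdges C) (cycleEdges D) → (B : BalancedCodes (length (verts C))) →
                 map (sgn (a , b)) (cycPairs (verts C)) ∈ codes B
    cycle-code C D disj B = complete B _ (trans (length-map _ (cycPairs (verts C))) (length-cycPairs C))
      (signs-balanced {H = H} 0<b (Valid⇒Bounded H {a} (proj₁ facet)) (cycPairs (verts C)) (closed C)
        (drop-along-cycle C a) (cycle-#nil≤1 H connected size 0<b rigid C D disj))

  -- Equal codes give the same tight edges and hence the same face, so distinct facets have distinct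
  -- codes.
  codes! : Unique (map code fs)
  codes! = AllPairs.map⁺ (AllPairs-map-∈ (λ f∈ g∈ ¬same eq → ¬same (same-code f∈ g∈ eq)) distinctFaces)
    where
    same-code : ∀ {f g} → f ∈ fs → g ∈ fs → code f ≡ code g → SameFace (sepGens H) f g
    same-code {f} {g} f∈ g∈ eq = SameTight⇒SameFace H f g λ where
        (inj₁ e∈) → proj₁ (on-edge e∈)
        (inj₂ e∈) → proj₂ (on-edge e∈)
      where
      on-list : ∀ {u w ps} → map (sgn f) ps ≡ map (sgn g) ps → (u , w) ∈ ps → SameTight f g u w × SameTight f g w u
      on-list eq p∈ = sgn⇒SameTight (positive f∈) (positive g∈) (map-≡⇒≡ eq p∈)
        where
        map-≡⇒≡ : ∀ {ps p} → map (sgn f) ps ≡ map (sgn g) ps → p ∈ ps → sgn f p ≡ sgn g p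
        map-≡⇒≡ eq (here refl) = ∷-injectiveˡ eq
        map-≡⇒≡ eq (there p∈)  = map-≡⇒≡ (∷-injectiveʳ eq) p∈
      on-cycle : ∀ {u w} (Z : Cycle H) → map (sgn f) (cycPairs (verts Z)) ≡ map (sgn g) (cycPairs (verts Z)) →
                 (u , w) ∈ cycleEdges Z → SameTight f g u w × SameTight f g w u
      on-cycle Z eq e∈ with ∈-map⁻ norm e∈
      ... | p , p∈ , e≡ with norm-cases p
      ... | inj₁ n≡ with refl ← trans e≡ n≡ = on-list eq p∈
      -- The cycle runs through this edge against its stored orientation, so the two halves of the
      -- conclusion are exchanged.
      ... | inj₂ n≡ with refl ← trans e≡ n≡ = let s , t = on-list eq p∈ in t , s
      on-edge : ∀ {u w} → (u , w) ∈ edges H → SameTight f g u w × SameTight f g w u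
      on-edge {u} {w} e∈ with (u , w) ∈E? onCycles
      ... | no e∉ = on-list (,-injectiveʳ (,-injectiveʳ eq)) (∈-filter⁺ (λ e → ¬? (e ∈E? onCycles)) e∈ e∉)
      ... | yes e∈CD with ∈-++⁻ (cycleEdges C) e∈CD
      ... | inj₁ e∈C = on-cycle C (,-injectiveˡ eq) e∈C
      ... | inj₂ e∈D = on-cycle D (,-injectiveˡ (,-injectiveʳ eq)) e∈D
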